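{- Let $d$ be a positive integer and let $p_0^d(z) = d!\left(\binom{z+d}{d}+\binom{z}{d}\right)$. Let $f$ be a $CL$-polynomial of degree $d$ that satisfies $(\diamondsuit)$, i.e. whose $h^*$-polynomial has palindromic and non-negative coefficients. Then every root $-\frac12+\alpha\sqrt{ -1}$ (with $\alpha\in\mathbb{R}$) of $f$ satisfies $\alpha\leq\tilde{\alpha}_d$, where $$\tilde{\alpha}_d=\max\left\{ \beta\in\mathbb{R} : -\tfrac12+\beta\sqrt{ -1}\text{ is a root of }p_0^d \right\}.$$
   Context: The critical line is $CL=\{z\in\mathbb{C} : \mathrm{Re}(z)=-\frac12\}$. A $CL$-polynomial of degree $d$ is a polynomial of the form $f(z)=b(z)\prod_{i=0}^{\lfloor d/2\rfloor-1}(z^2+z+c_i)$, where the $c_i$ are real numbers $\geq\frac14$ and, for a non-zero constant $a$, $b(z)=a$ if $d$ is even and $b(z)=a(2z+1)$ if $d$ is odd. Its roots all lie on $CL$. For a polynomial $f$ of degree $d$, the $h^*$-polynomial is the polynomial $h^*(t)=\sum_{i=0}^d h^*_i t^i$ with $\sum_{k\ge 0} f(k)t^k=\frac{h^*(t)}{(1-t)^{d+1}}$; equivalently $f(z)=\sum_{i=0}^d h_i^*\binom{z+d-i}{d}$. Here $\binom{x}{d}=\frac{x(x-1)\cdots(x-d+1)}{d!}$. Palindromic means $h^*_i=h^*_{d-i}$ for all $0\le i\le d$. Property $(\diamondsuit)$ means that all $h^*_i$ are real and $\ge 0$ and that $h^*$ is palindromic. -}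

module Defs where

open import Algebra.Apartness.Bundles using (HeytingField)
open import Algebra.Bundles using (CommutativeRing)
open import Algebra.Bundles.Raw using (RawRing)
import Algebra.Definitions.RawSemiring as RawSemiringDefs
open import Data.Fin.Base using (Fin; toℕ)
open import Data.Nat.Base as ℕ using (ℕ; zero; suc; NonZero; _∸_; ⌊_/2⌋; parity; _!)
open import Data.Nat.Properties using (_!≢0)
open import Data.Parity.Base using (Parity; 0ℙ; 1ℙ)
open import Data.Product.Base using (∃; _×_; proj₁; proj₂)
open import Data.Sum.Base using (_⊎_)
open import Level using (Level; _⊔_) renaming (suc to lsuc)
open import Relation.Binary.Core using (Rel)
open import Relation.Binary.Structures using (IsStrictPartialOrder)
open import Relation.Nullary.Negation using (¬_)
open import Relation.Unary using (Pred)

-- The real numbers, characterised as a Cauchy-complete Archimedean ordered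
-- field; classically this determines ℝ up to unique isomorphism.  No
-- decidability of the order is assumed, so that the constructive Cauchy reals
-- are a model as well.

record RealField (c ℓ₁ ℓ₂ ℓ₃ : Level) : Set (lsuc (c ⊔ ℓ₁ ⊔ ℓ₂ ⊔ ℓ₃)) where
  infix 4 _<_ _≤_

  field
    heytingField : HeytingField c ℓ₁ ℓ₂

  open HeytingField heytingField public

  field
    _<_                  : Rel Carrier ℓ₃
    isStrictPartialOrder : IsStrictPartialOrder _≈_ _<_
    #⇒<⊎>                : ∀ {x y} → x # y → x < y ⊎ y < x
    <⇒#                  : ∀ {x y} → x < y → x # y
    0<1                  : 0# < 1#
    +-monoˡ-<            : ∀ {x y} z → x < y → x + z < y + z
    *-pos                : ∀ {x y} → 0# < x → 0# < y → 0# < x * y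

  _≤_ : Rel Carrier ℓ₃
  x ≤ y = ¬ (y < x)

  commutativeRing : CommutativeRing c ℓ₁
  commutativeRing = record { isCommutativeRing = isCommutativeRing }

  open RawSemiringDefs (RawRing.rawSemiring (CommutativeRing.rawRing commutativeRing)) public
    using () renaming (_×_ to _·_)

  -- |s m - s n| < ε for all m, n ≥ N; the two-sided bound follows by
  -- exchanging m and n.
  IsCauchy : (ℕ → Carrier) → Set (c ⊔ ℓ₃)
  IsCauchy s = ∀ ε → 0# < ε →
    ∃ λ N → ∀ m n → N ℕ.≤ m → N ℕ.≤ n → s m < s n + ε

  _ConvergesTo_ : (ℕ → Carrier) → Carrier → Set (c ⊔ ℓ₃)
  s ConvergesTo x = ∀ ε → 0# < ε →
    ∃ λ N → ∀ n → N ℕ.≤ n → s n < x + ε × x < s n + ε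

  field
    archimedean : ∀ x → ∃ λ n → x < n · 1#
    complete    : ∀ s → IsCauchy s → ∃ λ x → s ConvergesTo x

  0<suc : ∀ n → 0# < suc n · 1#
  0<suc zero    = proj₁ (IsStrictPartialOrder.<-resp-≈ isStrictPartialOrder)
                    (sym (+-identityʳ 1#)) 0<1
  0<suc (suc n) = IsStrictPartialOrder.trans isStrictPartialOrder (0<suc n)
                    (proj₂ (IsStrictPartialOrder.<-resp-≈ isStrictPartialOrder)
                      (+-identityˡ _) (+-monoˡ-< _ 0<1))

  -- The inverse of n · 1#.
  1/_ : ∀ n → .{{NonZero n}} → Carrier
  1/ suc n = proj₁ (#⇒invertible (#-sym (<⇒# (0<suc n))))

  IsMaximum : ∀ {p} → Pred Carrier p → Pred Carrier (c ⊔ ℓ₃ ⊔ p)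
  IsMaximum P m = P m × (∀ x → P x → x ≤ m)

module OverReals {c ℓ₁ ℓ₂ ℓ₃ : Level} (R : RealField c ℓ₁ ℓ₂ ℓ₃) where

  open RealField R public
    using (_<_; _≤_; 1/_; IsMaximum)
    renaming (Carrier to ℝ; _≈_ to _≈ᵣ_; _+_ to _+ᵣ_; _*_ to _*ᵣ_; -_ to -ᵣ_;
              0# to 0ᵣ; 1# to 1ᵣ)

  infix  4 _≈_
  infix  5 _+i_
  infixl 6 _+_ _-_
  infixl 7 _*_
  infix  8 -_

  record ℂ : Set c where
    constructor _+i_
    field
      re im : ℝ
  open ℂ public

  _≈_ : Rel ℂ ℓ₁
  w ≈ z = re w ≈ᵣ re z × im w ≈ᵣ im z

  _+_ _*_ : ℂ → ℂ → ℂ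
  w + z = (re w +ᵣ re z) +i (im w +ᵣ im z)
  w * z = (re w *ᵣ re z +ᵣ -ᵣ (im w *ᵣ im z)) +i (re w *ᵣ im z +ᵣ im w *ᵣ re z)

  -_ : ℂ → ℂ
  - z = (-ᵣ re z) +i (-ᵣ im z)

  _-_ : ℂ → ℂ → ℂ
  w - z = w + (- z)

  fromℝ : ℝ → ℂ
  fromℝ x = x +i 0ᵣ

  0ℂ 1ℂ : ℂ
  0ℂ = fromℝ 0ᵣ
  1ℂ = fromℝ 1ᵣ

  rawRing : RawRing c ℓ₁
  rawRing = record
    { Carrier = ℂ ; _≈_ = _≈_ ; _+_ = _+_ ; _*_ = _*_ ; -_ = -_
    ; 0# = 0ℂ ; 1# = 1ℂ }

  open RawSemiringDefs (RawRing.rawSemiring rawRing) public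
    using (sum; product) renaming (_×_ to _·_)

  fromℕ : ℕ → ℂ
  fromℕ n = n · 1ℂ

  -- ℂ being infinite, polynomials over ℂ are identified with the functions
  -- ℂ → ℂ they induce.

  IsRoot : (ℂ → ℂ) → Pred ℂ ℓ₁
  IsRoot f z = f z ≈ 0ℂ

  onCL : ℝ → ℂ
  onCL α = (-ᵣ (1/ 2)) +i α

  binom : ℂ → ℕ → ℂ
  binom x d = product {d} (λ j → x - fromℕ (toℕ j)) * fromℝ (1/ (d !))
    where instance _ = d !≢0

  p₀ : ℕ → ℂ → ℂ
  p₀ d z = fromℕ (d !) * (binom (z + fromℕ d) d + binom z d)

  leadingFactor : Parity → ℂ → ℂ → ℂ
  leadingFactor 0ℙ a z = a
  leadingFactor 1ℙ a z = a * (fromℕ 2 * z + 1ℂ)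

  record IsCLPolynomial (d : ℕ) (f : ℂ → ℂ) : Set (c ⊔ ℓ₁ ⊔ ℓ₃) where
    field
      a    : ℂ
      a≉0  : ¬ (a ≈ 0ℂ)
      cs   : Fin ⌊ d /2⌋ → ℝ
      cs≥¼ : ∀ i → 1/ 4 ≤ cs i
      form : ∀ z → f z ≈ leadingFactor (parity d) a z
                         * product (λ i → z * z + z + fromℝ (cs i))

  -- Formal power series over ℂ, as coefficient sequences.

  Series : Set c
  Series = ℕ → ℂ

  oneₛ oneMinusT : Series
  oneₛ zero    = 1ℂ
  oneₛ (suc _) = 0ℂ

  oneMinusT zero          = 1ℂ
  oneMinusT (suc zero)    = - 1ℂ
  oneMinusT (suc (suc _)) = 0ℂ

  infixl 7 _*ₛ_
  infixr 8 _^ₛ_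

  _*ₛ_ : Series → Series → Series
  (u *ₛ v) n = sum {suc n} (λ i → u (toℕ i) * v (n ∸ toℕ i))

  _^ₛ_ : Series → ℕ → Series
  u ^ₛ zero  = oneₛ
  u ^ₛ suc n = u *ₛ (u ^ₛ n)

  -- Σₖ f(k) tᵏ = h(t) / (1 - t)ᵈ⁺¹, with denominators cleared.
  record IsHStar (d : ℕ) (f : ℂ → ℂ) (h : Series) : Set ℓ₁ where
    field
      degree≤d : ∀ i → d ℕ.< i → h i ≈ 0ℂ
      genFun   : ∀ n → ((oneMinusT ^ₛ suc d) *ₛ (λ k → f (fromℕ k))) n ≈ h n

  record Diamond (d : ℕ) (f : ℂ → ℂ) : Set (c ⊔ ℓ₁ ⊔ ℓ₃) where
    field
      h*          : Series
      isHStar     : IsHStar d f h*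
      real        : ∀ i → i ℕ.≤ d → im (h* i) ≈ᵣ 0ᵣ
      nonNegative : ∀ i → i ℕ.≤ d → 0ᵣ ≤ re (h* i)
      palindromic : ∀ i → i ℕ.≤ d → h* i ≈ h* (d ∸ i)

{-# OPTIONS --safe #-}
-- On the critical line, z = -½ + ix gives z + m = i (x - i (m - ½)) and
-- z - m = i (x + i (m + ½)).  With P n = ∏_{m<n} (x - i (m + ½)) one gets
-- p₀ d z = 2 iᵈ Re (P d) and d! f(z) = iᵈ Σⱼ h*ⱼ P (d-j) conj(P j).  The angle
-- Σ_{m<n} arctan ((m + ½)/x) of conj(P n) decreases in x > 0, and α̃ is the x at
-- which it is a quarter turn for n = d.  For x > α̃ all P j, j ≤ d, lie in the
-- fourth quadrant, so all Re (P (d-j) conj(P j)) are positive; as all h*ⱼ ≥ 0,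
-- f(z) = 0 then forces h*₀ = f(0) = 0, which no CL-polynomial satisfies.
--
-- Constructively, α̃ is the cut of the set of x for which P 1, …, P d lie in the
-- right half plane: this set is open, upward closed and located, since
-- Re (P (n+1)) / Re (P n) is strictly increasing on it.
module Submission where

-- Positivity of `A d` alone does not mark the points above the largest root: for larger `d`, once
-- the angle exceeds three quarters of a turn, `A d` is positive again below that root. Constraining
-- every partial product instead gives an upward closed set.
--
-- With an undecidable order, neither a sign search nor picking the largest of several roots is
-- available. A set yields a real number once membership can be tested up to an arbitrarily small
-- gap, and the strictly increasing ratios provide that gap.
--
-- The hypothesis on `h*` sees `f` at natural numbers only. To evaluate it at a complex point, `f`
-- and its expansion must be recognised as polynomial functions agreeing on all naturals. Since both
-- are bare functions, a Newton form is carried along as evidence of polynomiality; peeling off its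
-- nodes one by one shows that the difference vanishes.

open import Defs
open import Algebra.Apartness.Bundles using (HeytingField)
import Algebra.Apartness.Properties.HeytingCommutativeRing as HeytingProperties
open import Algebra.Bundles using (CommutativeRing; RawRing)
import Algebra.Definitions.RawSemiring as RawSemiringDefs
import Algebra.Properties.AbelianGroup as AbelianGroupProperties
import Algebra.Properties.Monoid.Mult.TCOptimised as TCMult
import Algebra.Properties.Ring as RingProperties
import Algebra.Properties.Semiring.Exp as SemiringExp
import Algebra.Properties.Semiring.Mult as SemiringMult
import Algebra.Properties.Semiring.Sum as SemiringSum
import Algebra.Solver.Ring as RingSolver
open import Algebra.Solver.Ring.AlmostCommutativeRing using (_-Raw-AlmostCommutative⟶_; fromCommutativeRing; Induced-equivalence)
open import Data.Fin.Base as Fin using (Fin; toℕ)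
open import Data.Fin.Properties using (toℕ<n)
open import Data.Integer.Base as ℤ using (ℤ; +_; -[1+_]; _⊖_)
import Data.Integer.Properties as ℤ
open import Data.Maybe.Base using (just; nothing)
open import Data.Nat.Base as ℕ using (ℕ; zero; suc; NonZero; _∸_; _!; parity)
import Data.Nat.Properties as ℕ
open import Data.Parity.Base using (0ℙ; 1ℙ)
open import Data.Product.Base using (Σ; ∃; _×_; _,_; proj₁; proj₂)
open import Data.Sum.Base using (_⊎_; inj₁; inj₂; [_,_]′)
open import Data.Unit.Polymorphic.Base using (⊤; tt)
open import Function.Base using (_∘_)
open import Level using (Level; _⊔_)
open import Relation.Binary.Definitions using (WeaklyDecidable)
import Relation.Binary.PropositionalEquality as ≡
import Relation.Binary.Reasoning.Setoid as SetoidReasoning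
open import Relation.Binary.Structures using (IsStrictPartialOrder)
open import Relation.Nullary.Decidable.Core using (yes; no)
open import Relation.Nullary.Negation using (¬_; contradiction)

-- The ring solver with integer coefficients: unlike the solvers of the
-- library it cancels x - x without deciding equality in the ring.
module IntegerSolver {c ℓ : Level} (R : CommutativeRing c ℓ) where
  open CommutativeRing R
  open RingProperties ring
  open AbelianGroupProperties +-abelianGroup using (⁻¹-∙-comm)
  open TCMult +-monoid using (×ᵤ≈×) renaming (_×_ to _·_)
  open SemiringMult semiring using (×-homo-+; ×1-homo-*) renaming (_×_ to _·ᵤ_)
  open SetoidReasoning setoid

  -- The optimised multiple makes `⟦ + 1 ⟧` reduce to `1#`, so `con (+ 1)` denotes the unit on the
  -- nose.
  ⟦_⟧ : ℤ → Carrier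
  ⟦ + n ⟧      = n · 1#
  ⟦ -[1+ n ] ⟧ = - (suc n · 1#)

  private
    ×-+ : ∀ m n → (m ℕ.+ n) · 1# ≈ m · 1# + n · 1#
    ×-+ m n = begin
      (m ℕ.+ n) · 1#        ≈⟨ ×ᵤ≈× (m ℕ.+ n) 1# ⟨
      (m ℕ.+ n) ·ᵤ 1#       ≈⟨ ×-homo-+ 1# m n ⟩
      m ·ᵤ 1# + n ·ᵤ 1#     ≈⟨ +-cong (×ᵤ≈× m 1#) (×ᵤ≈× n 1#) ⟩
      m · 1# + n · 1#       ∎

    ×-* : ∀ m n → (m ℕ.* n) · 1# ≈ (m · 1#) * (n · 1#)
    ×-* m n = begin
      (m ℕ.* n) · 1#        ≈⟨ ×ᵤ≈× (m ℕ.* n) 1# ⟨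
      (m ℕ.* n) ·ᵤ 1#       ≈⟨ ×1-homo-* m n ⟩
      (m ·ᵤ 1#) * (n ·ᵤ 1#) ≈⟨ *-cong (×ᵤ≈× m 1#) (×ᵤ≈× n 1#) ⟩
      (m · 1#) * (n · 1#)   ∎

    cancel-1 : ∀ x y → x - y ≈ (1# + x) - (1# + y)
    cancel-1 x y = sym (begin
      (1# + x) + - (1# + y)     ≈⟨ +-cong (+-comm 1# x) (sym (⁻¹-∙-comm 1# y)) ⟩
      (x + 1#) + (- 1# + - y)   ≈⟨ +-assoc x 1# _ ⟩
      x + (1# + (- 1# + - y))   ≈⟨ +-congˡ (sym (+-assoc 1# _ _)) ⟩
      x + ((1# + - 1#) + - y)   ≈⟨ +-congˡ (+-congʳ (-‿inverseʳ 1#)) ⟩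
      x + (0# + - y)            ≈⟨ +-congˡ (+-identityˡ _) ⟩
      x + - y                   ∎)

    ⊖-homo : ∀ m n → ⟦ m ⊖ n ⟧ ≈ m · 1# - n · 1#
    ⊖-homo zero    zero    = sym (-‿inverseʳ 0#)
    ⊖-homo zero    (suc n) = sym (+-identityˡ _)
    ⊖-homo (suc m) zero    = sym (trans (+-congˡ -0#≈0#) (+-identityʳ _))
    ⊖-homo (suc m) (suc n) = begin
      ⟦ suc m ⊖ suc n ⟧               ≡⟨ ≡.cong ⟦_⟧ (ℤ.[1+m]⊖[1+n]≡m⊖n m n) ⟩
      ⟦ m ⊖ n ⟧                       ≈⟨ ⊖-homo m n ⟩
      m · 1# - n · 1#                 ≈⟨ cancel-1 _ _ ⟩
      (1# + m · 1#) - (1# + n · 1#)   ≈⟨ +-cong (×-+ 1 m) (-‿cong (×-+ 1 n)) ⟨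
      suc m · 1# - suc n · 1#         ∎

    +-homo : ∀ i j → ⟦ i ℤ.+ j ⟧ ≈ ⟦ i ⟧ + ⟦ j ⟧
    +-homo (+ m)      (+ n)      = ×-+ m n
    +-homo (+ m)      -[1+ n ]   = ⊖-homo m (suc n)
    +-homo -[1+ m ]   (+ n)      = trans (⊖-homo n (suc m)) (+-comm _ _)
    +-homo -[1+ m ]   -[1+ n ]   = begin
      - (suc (suc (m ℕ.+ n)) · 1#)      ≡⟨ ≡.cong (λ k → - (suc k · 1#)) (ℕ.+-suc m n) ⟨
      - ((suc m ℕ.+ suc n) · 1#)        ≈⟨ -‿cong (×-+ (suc m) (suc n)) ⟩
      - (suc m · 1# + suc n · 1#)       ≈⟨ ⁻¹-∙-comm _ _ ⟨
      - (suc m · 1#) + - (suc n · 1#)   ∎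

    -‿homo : ∀ i → ⟦ ℤ.- i ⟧ ≈ - ⟦ i ⟧
    -‿homo (+ zero)   = sym -0#≈0#
    -‿homo (+ suc n)  = refl
    -‿homo -[1+ n ]   = sym (-‿involutive _)

    +*-homo : ∀ m j → ⟦ + m ℤ.* j ⟧ ≈ ⟦ + m ⟧ * ⟦ j ⟧
    +*-homo m (+ n) = trans (reflexive (≡.cong ⟦_⟧ (≡.sym (ℤ.pos-* m n)))) (×-* m n)
    +*-homo m -[1+ n ] = begin
      ⟦ + m ℤ.* -[1+ n ] ⟧           ≡⟨ ≡.cong ⟦_⟧ (ℤ.neg-distribʳ-* (+ m) (+ suc n)) ⟨
      ⟦ ℤ.- (+ m ℤ.* + suc n) ⟧      ≈⟨ -‿homo (+ m ℤ.* + suc n) ⟩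
      - ⟦ + m ℤ.* + suc n ⟧          ≈⟨ -‿cong (+*-homo m (+ suc n)) ⟩
      - (⟦ + m ⟧ * ⟦ + suc n ⟧)      ≈⟨ -‿distribʳ-* _ _ ⟩
      ⟦ + m ⟧ * - ⟦ + suc n ⟧        ∎
    *-homo : ∀ i j → ⟦ i ℤ.* j ⟧ ≈ ⟦ i ⟧ * ⟦ j ⟧
    *-homo (+ m)    j = +*-homo m j
    *-homo -[1+ m ] j = begin
      ⟦ -[1+ m ] ℤ.* j ⟧             ≡⟨ ≡.cong ⟦_⟧ (ℤ.neg-distribˡ-* (+ suc m) j) ⟨
      ⟦ ℤ.- (+ suc m ℤ.* j) ⟧        ≈⟨ -‿homo (+ suc m ℤ.* j) ⟩
      - ⟦ + suc m ℤ.* j ⟧            ≈⟨ -‿cong (+*-homo (suc m) j) ⟩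
      - (⟦ + suc m ⟧ * ⟦ j ⟧)        ≈⟨ -‿distribˡ-* _ _ ⟩
      - ⟦ + suc m ⟧ * ⟦ j ⟧          ∎

    morphism : ℤ.+-*-rawRing -Raw-AlmostCommutative⟶ fromCommutativeRing R
    morphism = record
      { ⟦_⟧    = ⟦_⟧
      ; +-homo = +-homo
      ; *-homo = *-homo
      ; -‿homo = -‿homo
      ; 0-homo = refl
      ; 1-homo = refl
      }

    dec : WeaklyDecidable (Induced-equivalence morphism)
    dec i j with i ℤ.≟ j
    ... | yes ≡.refl = just refl
    ... | no _       = nothing

  open RingSolver ℤ.+-*-rawRing (fromCommutativeRing R) morphism dec public
    using (solve; con; _:=_; _:+_; _:*_; _:-_; :-_)

-- Constructive order arithmetic in the reals

module OrderProperties {c ℓ₁ ℓ₂ ℓ₃ : Level} (R : RealField c ℓ₁ ℓ₂ ℓ₃) where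
  open RealField R
  open IntegerSolver commutativeRing public using (solve; con; _:=_; _:+_; _:*_; _:-_; :-_)
  open HeytingProperties (HeytingField.heytingCommutativeRing heytingField) using (invertibleˡ⇒#; x-0≈x)
  open SemiringMult (CommutativeRing.semiring commutativeRing) using (×-homo-+)
  open IsStrictPartialOrder isStrictPartialOrder public
    using () renaming (trans to <-trans; irrefl to <-irrefl; asym to <-asym)

  private variable
    x y z ε : Carrier

  <-respʳ : x ≈ y → z < x → z < y
  <-respʳ = proj₁ (IsStrictPartialOrder.<-resp-≈ isStrictPartialOrder)

  <-respˡ : x ≈ y → x < z → y < z
  <-respˡ = proj₂ (IsStrictPartialOrder.<-resp-≈ isStrictPartialOrder)

  -- The substitute for trichotomy: a point can always be compared with one of two separated points.
  -- It is inherited from cotransitivity of apartness.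
  <-cotrans : x < y → ∀ z → x < z ⊎ z < y
  <-cotrans x<y z with #-cotrans (<⇒# x<y) z
  <-cotrans x<y z | inj₁ x#z with #⇒<⊎> x#z
  ... | inj₁ x<z = inj₁ x<z
  ... | inj₂ z<x = inj₂ (<-trans z<x x<y)
  <-cotrans x<y z | inj₂ z#y with #⇒<⊎> z#y
  ... | inj₁ z<y = inj₂ z<y
  ... | inj₂ y<z = inj₁ (<-trans x<y y<z)

  x<y⇒0<y-x : x < y → 0# < y - x
  x<y⇒0<y-x {x} x<y = <-respˡ (-‿inverseʳ x) (+-monoˡ-< (- x) x<y)

  0<y-x⇒x<y : 0# < y - x → x < y
  0<y-x⇒x<y {y} {x} p = <-respˡ (+-identityˡ x)
    (<-respʳ (solve 2 (λ y x → y :- x :+ x := y) refl y x) (+-monoˡ-< x p))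

  0<y-x⇐ : z ≈ y - x → 0# < z → x < y
  0<y-x⇐ eq p = 0<y-x⇒x<y (<-respʳ eq p)

  x<0⇒0<-x : x < 0# → 0# < - x
  x<0⇒0<-x x<0 = <-respʳ (+-identityˡ _) (x<y⇒0<y-x x<0)

  +-pos : 0# < x → 0# < y → 0# < x + y
  +-pos {x} {y} 0<x 0<y = <-trans 0<y (<-respˡ (+-identityˡ y) (+-monoˡ-< y 0<x))

  +-monoʳ-< : ∀ z → x < y → z + x < z + y
  +-monoʳ-< z x<y = <-respˡ (+-comm _ z) (<-respʳ (+-comm _ z) (+-monoˡ-< z x<y))

  pos⇒nonNeg : 0# < x → 0# ≤ x
  pos⇒nonNeg = <-asym

  nonNeg-resp : x ≈ y → 0# ≤ x → 0# ≤ y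
  nonNeg-resp x≈y 0≤x y<0 = 0≤x (<-respˡ (sym x≈y) y<0)

  -- As `0# ≤ y` is a negation, it cannot be added directly; `y` is first located relative to the
  -- gap between `- x` and zero.
  pos+nonNeg : 0# < x → 0# ≤ y → 0# < x + y
  pos+nonNeg {x} {y} 0<x 0≤y
    with <-cotrans (0<y-x⇐ (solve 1 (λ x → x := con (+ 0) :- :- x) refl x) 0<x) y
  ... | inj₁ -x<y = <-respʳ (solve 2 (λ x y → y :- :- x := x :+ y) refl x y) (x<y⇒0<y-x -x<y)
  ... | inj₂ y<0  = contradiction y<0 0≤y

  nonNeg+pos : 0# ≤ x → 0# < y → 0# < x + y
  nonNeg+pos 0≤x 0<y = <-respʳ (+-comm _ _) (pos+nonNeg 0<y 0≤x)

  +-nonNeg : 0# ≤ x → 0# ≤ y → 0# ≤ x + y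
  +-nonNeg {x} {y} 0≤x 0≤y x+y<0 =
    <-irrefl (solve 2 (λ x y → con (+ 0) := :- (x :+ y) :+ x :+ y) refl x y)
      (pos+nonNeg (pos+nonNeg (x<0⇒0<-x x+y<0) 0≤x) 0≤y)

  -- An inverse of `x * y`, multiplied by `x`, inverts `y`. This recovers apartness for a factor
  -- where contradiction would only give a double negation.
  0<xy⇒y#0 : 0# < x * y → y # 0#
  0<xy⇒y#0 {x} {y} 0<xy with #⇒invertible (#-sym (<⇒# 0<xy))
  ... | w , w[xy-0]≈1 , _ = invertibleˡ⇒#
    (w * x , trans (solve 3 (λ w x y → (w :* x) :* (y :- con (+ 0)) := w :* (x :* y :- con (+ 0))) refl w x y) w[xy-0]≈1)

  0<xy⇒0<y : 0# ≤ y → 0# < x * y → 0# < y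
  0<xy⇒0<y 0≤y 0<xy with #⇒<⊎> (0<xy⇒y#0 0<xy)
  ... | inj₁ y<0 = contradiction y<0 0≤y
  ... | inj₂ 0<y = 0<y

  *-cancelˡ-pos : 0# < x → 0# < x * y → 0# < y
  *-cancelˡ-pos {x} {y} 0<x 0<xy = 0<xy⇒0<y
    (λ y<0 → <-irrefl (solve 2 (λ x y → con (+ 0) := x :* y :+ x :* :- y) refl x y)
      (+-pos 0<xy (*-pos 0<x (x<0⇒0<-x y<0)))) 0<xy

  -- A negative product would make both factors apart from zero, hence positive, and so would itself
  -- be positive.
  *-nonNeg : 0# ≤ x → 0# ≤ y → 0# ≤ x * y
  *-nonNeg {x} {y} 0≤x 0≤y xy<0 = <-asym xy<0 (*-pos 0<x 0<y)
    where
    0<-xy : 0# < - (x * y)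
    0<-xy = x<0⇒0<-x xy<0
    0<y : 0# < y
    0<y = 0<xy⇒0<y 0≤y (<-respʳ (solve 2 (λ x y → :- (x :* y) := (:- x) :* y) refl x y) 0<-xy)
    0<x : 0# < x
    0<x = 0<xy⇒0<y 0≤x (<-respʳ (solve 2 (λ x y → :- (x :* y) := (:- y) :* x) refl x y) 0<-xy)

  nonNeg∧nonPos⇒≈0 : 0# ≤ x → x ≤ 0# → x ≈ 0#
  nonNeg∧nonPos⇒≈0 {x} 0≤x x≤0 = proj₁ (tight x 0#) λ x#0 → case (#⇒<⊎> x#0)
    where
    case : ¬ (x < 0# ⊎ 0# < x)
    case (inj₁ x<0) = 0≤x x<0
    case (inj₂ 0<x) = x≤0 0<x

  0≤n·1 : ∀ n → 0# ≤ n · 1#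
  0≤n·1 zero    = <-irrefl refl
  0≤n·1 (suc n) = pos⇒nonNeg (0<suc n)

  ·-mono : ∀ {m n} → m ℕ.≤ n → 0# ≤ n · 1# - m · 1#
  ·-mono {m} {n} m≤n = nonNeg-resp eq (0≤n·1 (n ∸ m))
    where
    eq : (n ∸ m) · 1# ≈ n · 1# - m · 1#
    eq = trans (solve 2 (λ a b → a := b :+ a :- b) refl ((n ∸ m) · 1#) (m · 1#))
      (+-congʳ (trans (sym (×-homo-+ 1# m (n ∸ m)))
        (reflexive (≡.cong (_· 1#) (ℕ.m+[n∸m]≡n m≤n)))))

  inverse : 0# < x → ∃ λ x⁻¹ → x * x⁻¹ ≈ 1#
  inverse {x} 0<x with #⇒invertible (#-sym (<⇒# 0<x))
  ... | x⁻¹ , _ , eq = x⁻¹ , trans (*-congʳ (sym (x-0≈x x))) eq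

  n*1/n≈1 : ∀ n .{{_ : NonZero n}} → (n · 1#) * 1/ n ≈ 1#
  n*1/n≈1 (suc n) = trans (*-congʳ (sym (x-0≈x _)))
    (proj₂ (proj₂ (#⇒invertible (#-sym (<⇒# (0<suc n))))))

  0<1/ : ∀ n → 0# < 1/ suc n
  0<1/ n = *-cancelˡ-pos (0<suc n) (<-respʳ (sym (n*1/n≈1 (suc n))) 0<1)

  Eventually : ∀ {p} → (ℕ → Set p) → Set p
  Eventually P = ∃ λ N → ∀ n → N ℕ.≤ n → P n

  eventually-× : ∀ {p q} {P : ℕ → Set p} {Q : ℕ → Set q} →
    Eventually P → Eventually Q → Eventually (λ n → P n × Q n)
  eventually-× (M , p) (N , q) = M ℕ.+ N , λ n M+N≤n →
    p n (ℕ.≤-trans (ℕ.m≤m+n M N) M+N≤n) , q n (ℕ.≤-trans (ℕ.m≤n+m N M) M+N≤n)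

  witness : ∀ {p} {P : ℕ → Set p} → Eventually P → ∃ P
  witness (N , p) = N , p N ℕ.≤-refl

  1/-small : ∀ M → 0# < ε → Eventually (λ n → M * 1/ suc n < ε)
  1/-small {ε} M 0<ε with inverse 0<ε
  -- Any bound above M/ε serves as threshold.
  ... | ε⁻¹ , εε⁻¹≈1 with archimedean (M * ε⁻¹)
  ... | N , Mε⁻¹<N = N , λ n N≤n → small n (·-mono N≤n)
    where
    M<Nε : 0# < ε * (N · 1#) - M
    M<Nε = <-respʳ
      (trans (solve 4 (λ ε N M i → ε :* (N :- M :* i) := ε :* N :- M :* (ε :* i)) refl ε (N · 1#) M ε⁻¹)
        (+-congˡ (-‿cong (trans (*-congˡ εε⁻¹≈1) (*-identityʳ M)))))
      (*-pos 0<ε (x<y⇒0<y-x Mε⁻¹<N))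
    small : ∀ n → 0# ≤ n · 1# - N · 1# → M * 1/ suc n < ε
    small n N≤n = 0<y-x⇒x<y (*-cancelˡ-pos (0<suc n) (<-respʳ
      (trans (solve 4 (λ ε n N M → ε :* N :- M :+ (ε :* (n :- N) :+ ε) := ε :* (con (+ 1) :+ n) :- M :* con (+ 1))
          refl ε (n · 1#) (N · 1#) M)
        (trans (+-congˡ (-‿cong (*-congˡ (sym (n*1/n≈1 (suc n))))))
          (solve 4 (λ ε n M i → ε :* n :- M :* (n :* i) := n :* (ε :- M :* i)) refl ε (suc n · 1#) M (1/ suc n))))
      (+-pos M<Nε (nonNeg+pos (*-nonNeg (pos⇒nonNeg 0<ε) N≤n) 0<ε))))

  ½ : Carrier
  ½ = 1/ 2

  0<½ : 0# < ½
  0<½ = 0<1/ 1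

  ½+½≈1 : ½ + ½ ≈ 1#
  -- The coefficient spells out `2 · 1#`, which unfolds to `1# + (1# + 0#)`.
  ½+½≈1 = trans (solve 1 (λ h → h :+ h := (con (+ 1) :+ (con (+ 1) :+ con (+ 0))) :* h) refl ½) (n*1/n≈1 2)

  x½+x½≈x : ∀ x → x * ½ + x * ½ ≈ x
  x½+x½≈x x = trans (sym (distribˡ x ½ ½)) (trans (*-congˡ ½+½≈1) (*-identityʳ x))

  dense : x < y → ∃ λ m → x < m × m < y
  dense {x} {y} x<y = x + e , 0<y-x⇐ (solve 2 (λ x e → e := x :+ e :- x) refl x e) 0<e ,
    0<y-x⇐ eq 0<e
    where
    e = (y - x) * ½
    0<e : 0# < e
    0<e = *-pos (x<y⇒0<y-x x<y) 0<½
    eq : e ≈ y - (x + e)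
    eq = trans (solve 2 (λ e x → e := (e :+ e) :+ x :- (x :+ e)) refl e x)
      (+-congʳ (trans (+-congʳ (x½+x½≈x (y - x))) (solve 2 (λ y x → y :- x :+ x := y) refl y x)))

-- Real numbers from located upper sets

module Cut {c ℓ₁ ℓ₂ ℓ₃ : Level} (R : RealField c ℓ₁ ℓ₂ ℓ₃) where
  open RealField R
  open OrderProperties R

  module _ {p} (U : Carrier → Set p)
    (U-upward  : ∀ {x y} → x < y → U x → U y)
    (U-located : ∀ {x y} → x < y → ¬ U x ⊎ U y)
    where

    -- Walk upwards from `lo` in steps of `δ`. Locatedness needs two distinct points, so each test
    -- compares `lo + δ` with `lo + 2δ`: either the walk goes on, or `U` is reached within `2δ`. The
    -- counter bounds the walk, which cannot pass `hi` while staying outside `U`.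
    search : ∀ {δ hi} → 0# < δ → U hi → ∀ n lo → ¬ U lo → hi < lo + (n · 1#) * δ →
      ∃ λ a → ¬ U a × U (a + (δ + δ))
    search {δ} 0<δ Uhi zero lo ¬Ulo hi<lo = contradiction
      (U-upward (<-respʳ (solve 2 (λ l d → l :+ con (+ 0) :* d := l) refl lo δ) hi<lo) Uhi) ¬Ulo
    search {δ} 0<δ Uhi (suc n) lo ¬Ulo hi<
      with U-located (0<y-x⇐ (solve 2 (λ l d → d := l :+ (d :+ d) :- (l :+ d)) refl lo δ) 0<δ)
    ... | inj₁ ¬U = search 0<δ Uhi n (lo + δ) ¬U
      (<-respʳ (solve 3 (λ l n d → l :+ (con (+ 1) :+ n) :* d := l :+ d :+ n :* d) refl lo (n · 1#) δ) hi<)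
    ... | inj₂ U+ = lo , ¬Ulo , U+

    approximation : ∀ {lo hi} → ¬ U lo → U hi → ∀ n → ∃ λ a → ¬ U a × U (a + (1/ suc n + 1/ suc n))
    approximation {lo} {hi} ¬Ulo Uhi n = search (0<1/ n) Uhi N lo ¬Ulo
      (0<y-x⇐ eq (*-pos (x<y⇒0<y-x (proj₂ (archimedean ((hi - lo) * (suc n · 1#))))) (0<1/ n)))
      where
      -- So many steps of length 1/(n+1) lead from `lo` past `hi`.
      N = proj₁ (archimedean ((hi - lo) * (suc n · 1#)))
      eq : (N · 1# - (hi - lo) * (suc n · 1#)) * 1/ suc n ≈ lo + (N · 1#) * 1/ suc n - hi
      eq = trans (solve 5 (λ N h l s d → (N :- (h :- l) :* s) :* d := N :* d :- (h :- l) :* (s :* d))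
                   refl (N · 1#) hi lo (suc n · 1#) (1/ suc n))
          (trans (+-congˡ (-‿cong (*-congˡ (n*1/n≈1 (suc n)))))
            (solve 4 (λ N h l d → N :* d :- (h :- l) :* con (+ 1) := l :+ N :* d :- h) refl (N · 1#) hi lo (1/ suc n)))

    module _ (δ : ℕ → Carrier) (δ-small : ∀ {ε} → 0# < ε → Eventually (λ n → δ n < ε))
      (a : ℕ → Carrier) (¬Ua : ∀ n → ¬ U (a n)) (Ua+δ : ∀ n → U (a n + δ n))
      where

      -- No `a m` lies above any `a n + δ n`, since the former is outside `U` and the latter inside.
      -- The estimate therefore holds for every `m` as soon as `δ n` is small.
      approximation-cauchy : IsCauchy a
      approximation-cauchy ε 0<ε = proj₁ (δ-small 0<ε) , λ m n _ N≤n → close m n (proj₂ (δ-small 0<ε) n N≤n)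
        where
        close : ∀ m n → δ n < ε → a m < a n + ε
        close m n δ<ε with <-cotrans (+-monoʳ-< (a n) δ<ε) (a m)
        ... | inj₁ p = contradiction (U-upward p (Ua+δ n)) (¬Ua m)
        ... | inj₂ p = p

      limit-isCut : ∀ {α} → a ConvergesTo α → (∀ {x} → α < x → U x) × (∀ {x} → x < α → ¬ U x)
      limit-isCut {α} a→α = above , below
        where
        above : ∀ {x} → α < x → U x
        above {x} α<x = U-upward (0<y-x⇐ eq (+-pos (x<y⇒0<y-x a<α+e) (x<y⇒0<y-x δ<e))) (Ua+δ n)
          where
          -- Half of the gap absorbs the error of `a n`, the other half absorbs `δ n`.
          e = (x - α) * ½
          0<e : 0# < e
          0<e = *-pos (x<y⇒0<y-x α<x) 0<½
          close = witness (eventually-× (a→α e 0<e) (δ-small 0<e))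
          n = proj₁ close
          a<α+e = proj₁ (proj₁ (proj₂ close))
          δ<e = proj₂ (proj₂ close)
          eq : α + e - a n + (e - δ n) ≈ x - (a n + δ n)
          eq = trans (solve 4 (λ α e a d → α :+ e :- a :+ (e :- d) := (e :+ e) :+ α :- (a :+ d)) refl α e (a n) (δ n))
            (+-congʳ (trans (+-congʳ (x½+x½≈x (x - α))) (solve 2 (λ x α → x :- α :+ α := x) refl x α)))

        below : ∀ {x} → x < α → ¬ U x
        below {x} x<α Ux with witness (a→α (α - x) (x<y⇒0<y-x x<α))
        ... | n , _ , p = ¬Ua n (U-upward
          (0<y-x⇐ (solve 3 (λ a x α → a :+ (α :- x) :- α := a :- x) refl (a n) x α) (x<y⇒0<y-x p)) Ux)

    2/n-small : ∀ {ε} → 0# < ε → Eventually (λ n → 1/ suc n + 1/ suc n < ε)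
    2/n-small 0<ε = proj₁ small , λ n N≤n →
      <-respˡ (solve 1 (λ d → (con (+ 1) :+ con (+ 1)) :* d := d :+ d) refl (1/ suc n)) (proj₂ small n N≤n)
      where small = 1/-small (1# + 1#) 0<ε

    cut : ∃ (λ x → ¬ U x) → ∃ U → ∃ λ α → (∀ {x} → α < x → U x) × (∀ {x} → x < α → ¬ U x)
    cut (lo , ¬Ulo) (hi , Uhi) = proj₁ limit , limit-isCut _ 2/n-small a ¬Ua Ua+δ (proj₂ limit)
      where
      a : ℕ → Carrier
      a n = proj₁ (approximation ¬Ulo Uhi n)
      ¬Ua : ∀ n → ¬ U (a n)
      ¬Ua n = proj₁ (proj₂ (approximation ¬Ulo Uhi n))
      Ua+δ : ∀ n → U (a n + (1/ suc n + 1/ suc n))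
      Ua+δ n = proj₂ (proj₂ (approximation ¬Ulo Uhi n))
      limit : ∃ (a ConvergesTo_)
      limit = complete a (approximation-cauchy _ 2/n-small a ¬Ua Ua+δ)

-- Angles of the partial products and the largest zero of `A`

module LargestRoot {c ℓ₁ ℓ₂ ℓ₃ : Level} (R : RealField c ℓ₁ ℓ₂ ℓ₃) where
  open RealField R
  open OrderProperties R
  open Cut R

  private variable
    x x′ : Carrier
    n : ℕ

  y : ℕ → Carrier
  y n = n · 1# + ½

  0<y : ∀ n → 0# < y n
  0<y n = nonNeg+pos (0≤n·1 n) 0<½

  -- A n x + i B n x = ∏_{m<n} (x - i (m + ½)).
  A B : ℕ → Carrier → Carrier
  A zero    x = 1#
  A (suc n) x = x * A n x + y n * B n x
  B zero    x = 0#
  B (suc n) x = x * B n x + - y n * A n x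

  -- For x > 0: all partial products, hence the angle Σ_{m<n} arctan ((m + ½)/x),
  -- stay within a quarter turn.
  Pos : ℕ → Carrier → Set ℓ₃
  Pos zero    x = ⊤
  Pos (suc n) x = Pos n x × 0# < A (suc n) x

  Pos⇒0<A : ∀ n → Pos n x → 0# < A n x
  Pos⇒0<A zero    _       = 0<1
  Pos⇒0<A (suc n) (_ , p) = p

  Pos-≤ : ∀ {m} → m ℕ.≤′ n → Pos n x → Pos m x
  Pos-≤ ℕ.≤′-refl       p       = p
  Pos-≤ (ℕ.≤′-step m≤n) (p , _) = Pos-≤ m≤n p

  A₁≈x : ∀ x → A 1 x ≈ x
  A₁≈x x = solve 2 (λ x y → x :* con (+ 1) :+ y :* con (+ 0) := x) refl x (y 0)

  Pos⇒0<x : ∀ n → Pos (suc n) x → 0# < x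
  Pos⇒0<x {x} n p = <-respʳ (A₁≈x x) (proj₂ (Pos-≤ (ℕ.≤⇒≤′ (ℕ.s≤s (ℕ.z≤n {n}))) p))

  -B-suc : ∀ n x → x * - B n x + y n * A n x ≈ - B (suc n) x
  -B-suc n x = solve 4 (λ x y a b → x :* :- b :+ y :* a := :- (x :* b :+ :- y :* a)) refl x (y n) (A n x) (B n x)

  -- Only a weak inequality is possible, because `B 0` vanishes.
  Pos⇒B≤0 : ∀ n → Pos n x → 0# ≤ - B n x
  Pos⇒B≤0     zero    _ = nonNeg-resp (solve 0 (con (+ 0) := :- con (+ 0)) refl) (<-irrefl refl)
  Pos⇒B≤0 {x} (suc n) p = nonNeg-resp (-B-suc n x) (+-nonNeg
    (*-nonNeg (pos⇒nonNeg (Pos⇒0<x n p)) (Pos⇒B≤0 n (proj₁ p)))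
    (pos⇒nonNeg (*-pos (0<y n) (Pos⇒0<A n (proj₁ p)))))

  -- V + i W = conj(P m x) · P n x′, where P = A + i B.
  V W : ℕ → Carrier → ℕ → Carrier → Carrier
  V m x n x′ = A m x * A n x′ + B m x * B n x′
  W m x n x′ = A m x * B n x′ - A n x′ * B m x

  -- Two points of the fourth quadrant, neither on the imaginary axis, have directions less than a
  -- quarter turn apart.
  V-pos : ∀ m n → Pos m x → Pos n x′ → 0# < V m x n x′
  V-pos {x} {x′} m n p p′ = <-respʳ
    (solve 4 (λ a a′ b b′ → a :* a′ :+ (:- b) :* (:- b′) := a :* a′ :+ b :* b′) refl (A m x) (A n x′) (B m x) (B n x′))
    (pos+nonNeg (*-pos (Pos⇒0<A m p) (Pos⇒0<A n p′)) (*-nonNeg (Pos⇒B≤0 m p) (Pos⇒B≤0 n p′)))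

  -- The angle of `P n` turns back towards zero as `x` grows. Passing from `n` to `n + 1` multiplies
  -- `V + i W` by (x + iy)(x′ - iy), whose real part xx′ + y² and imaginary part y(x′ - x) are both
  -- positive.
  W-nonNeg : ∀ n → x < x′ → Pos n x → Pos n x′ → 0# ≤ W n x n x′
  W-nonNeg zero _ _ _ = nonNeg-resp
    (solve 0 (con (+ 0) := con (+ 1) :* con (+ 0) :- con (+ 1) :* con (+ 0)) refl) (<-irrefl refl)
  W-nonNeg {x} {x′} (suc n) x<x′ p p′ = nonNeg-resp
    (solve 7 (λ x x′ y a a′ b b′ →
        (a :* b′ :- a′ :* b) :* (x :* x′ :+ y :* y) :+ (a :* a′ :+ b :* b′) :* (y :* (x′ :- x))
        := (x :* a :+ y :* b) :* (x′ :* b′ :+ :- y :* a′) :- (x′ :* a′ :+ y :* b′) :* (x :* b :+ :- y :* a))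
      refl x x′ (y n) (A n x) (A n x′) (B n x) (B n x′))
    (+-nonNeg
      (*-nonNeg (W-nonNeg n x<x′ (proj₁ p) (proj₁ p′))
        (pos⇒nonNeg (+-pos (*-pos (Pos⇒0<x n p) (Pos⇒0<x n p′)) (*-pos (0<y n) (0<y n)))))
      (pos⇒nonNeg (*-pos (V-pos n n (proj₁ p) (proj₁ p′)) (*-pos (0<y n) (x<y⇒0<y-x x<x′)))))

  -- Cross-multiplied form of: A (suc n) / A n is increasing.
  ratio-mono : ∀ n → x < x′ → Pos n x → Pos n x′ → A n x′ * A (suc n) x < A n x * A (suc n) x′
  ratio-mono {x} {x′} n x<x′ p p′ = 0<y-x⇐
    (solve 7 (λ x x′ y a a′ b b′ →
        (x′ :- x) :* (a :* a′) :+ y :* (a :* b′ :- a′ :* b)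
        := a :* (x′ :* a′ :+ y :* b′) :- a′ :* (x :* a :+ y :* b))
      refl x x′ (y n) (A n x) (A n x′) (B n x) (B n x′))
    (pos+nonNeg (*-pos (x<y⇒0<y-x x<x′) (*-pos (Pos⇒0<A n p) (Pos⇒0<A n p′)))
      (*-nonNeg (pos⇒nonNeg (0<y n)) (W-nonNeg n x<x′ p p′)))

  -- A positive ratio `A (suc n) / A n` stays positive when it increases.
  Pos-upward : ∀ n → x < x′ → Pos n x → Pos n x′
  Pos-upward zero    _    _       = tt
  Pos-upward (suc n) x<x′ (p , q) = p′ , *-cancelˡ-pos (Pos⇒0<A n p)
    (<-trans (*-pos (Pos⇒0<A n p′) q) (ratio-mono n x<x′ p p′))
    where p′ = Pos-upward n x<x′ p

  -- The recursion is applied below an intermediate point `m`, so that `Pos n` is known at both `m`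
  -- and `x′`. The strict ratio inequality between these two then leaves a gap in which zero can be
  -- located; if the value at `m` is negative, upward closure excludes `x`.
  Pos-located : ∀ n → x < x′ → ¬ Pos n x ⊎ Pos n x′
  Pos-located zero _ = inj₂ tt
  Pos-located {x} {x′} (suc n) x<x′ =
    let (m , x<m , m<x′) = dense x<x′ in
    [ (λ ¬p → inj₁ λ q → ¬p (proj₁ q)) , step x<m m<x′ ]′ (Pos-located n x<m)
    where
    step : ∀ {m} → x < m → m < x′ → Pos n m → ¬ Pos (suc n) x ⊎ Pos (suc n) x′
    step x<m m<x′ p =
      [ (λ A*A<0 → inj₁ λ q → <-asym A*A<0 (*-pos (Pos⇒0<A n p′) (proj₂ (Pos-upward (suc n) x<m q))))
      , (λ 0<A*A → inj₂ (p′ , *-cancelˡ-pos (Pos⇒0<A n p) 0<A*A))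
      ]′ (<-cotrans (ratio-mono n m<x′ p p′) 0#)
      where p′ = Pos-upward n m<x′ p

  -- The ratio `A (suc n) / A n` equals x + y (B n / A n) with an increasing second summand, so it
  -- grows at least as fast as `x`. Moving right from `m` by more than its negated value at `m`
  -- makes it positive.
  Pos-inhabited : ∀ n → ∃ (Pos n)
  Pos-inhabited zero = 0# , tt
  Pos-inhabited (suc n) with Pos-inhabited n
  ... | m , p with inverse (Pos⇒0<A n p)
  ... | A⁻¹ , AA⁻¹≈1 with archimedean (- A (suc n) m * A⁻¹)
  ... | N , p< = x⁺ , p′ , *-cancelˡ-pos (Pos⇒0<A n p) (<-respʳ
      (solve 7 (λ x x′ y a a′ b b′ →
          a′ :* ((x :* a :+ y :* b) :+ (x′ :- x) :* a) :+ y :* (a :* b′ :- a′ :* b)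
          := a :* (x′ :* a′ :+ y :* b′))
        refl m x⁺ (y n) (A n m) (A n x⁺) (B n m) (B n x⁺))
      (pos+nonNeg (*-pos (Pos⇒0<A n p′) large) (*-nonNeg (pos⇒nonNeg (0<y n)) (W-nonNeg n m<x⁺ p p′))))
    where
    -- The successor keeps `x⁺` strictly to the right of `m` even if `N` is zero.
    x⁺ = m + (suc N · 1#)
    m<x⁺ : m < x⁺
    m<x⁺ = 0<y-x⇐ (solve 2 (λ m n → n := m :+ n :- m) refl m (suc N · 1#)) (0<suc N)
    p′ = Pos-upward n m<x⁺ p
    large : 0# < A (suc n) m + (x⁺ - m) * A n m
    large = <-respʳ
      (trans (solve 4 (λ a s i N → (N :- :- s :* i) :* a :+ a := s :* (a :* i) :+ (N :* a :+ a)) refl (A n m) (A (suc n) m) A⁻¹ (N · 1#))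
        (trans (+-congʳ (trans (*-congˡ AA⁻¹≈1) (*-identityʳ _)))
          (solve 4 (λ a s m N → s :+ (N :* a :+ a) := s :+ (m :+ (con (+ 1) :+ N) :- m) :* a) refl (A n m) (A (suc n) m) m (N · 1#))))
      (+-pos (*-pos (x<y⇒0<y-x p<) (Pos⇒0<A n p)) (Pos⇒0<A n p))

  ¬Pos-0 : ∀ n → ¬ Pos (suc n) 0#
  ¬Pos-0 n p = <-irrefl refl (Pos⇒0<x n p)

  -- Local Lipschitz bounds and continuity of `A` and `B`

  Within : Carrier → Carrier → Set ℓ₃
  Within M q = 0# < M - q × 0# < M + q

  within-+ : ∀ {M N q r} → Within M q → Within N r → Within (M + N) (q + r)
  within-+ {M} {N} {q} {r} (p₁ , p₂) (r₁ , r₂) =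
    <-respʳ (solve 4 (λ M N q r → (M :- q) :+ (N :- r) := M :+ N :- (q :+ r)) refl M N q r) (+-pos p₁ r₁) ,
    <-respʳ (solve 4 (λ M N q r → (M :+ q) :+ (N :+ r) := M :+ N :+ (q :+ r)) refl M N q r) (+-pos p₂ r₂)

  -- Twice `M * N ± q * r` is a sum of products of positive numbers, which avoids a case split on
  -- the signs of `q` and `r`.
  within-* : ∀ {M N q r} → Within M q → Within N r → Within (M * N) (q * r)
  within-* {M} {N} {q} {r} (p₁ , p₂) (r₁ , r₂) =
    *-cancelˡ-pos (+-pos 0<1 0<1) (<-respʳ
      (solve 4 (λ M N q r → (M :- q) :* (N :+ r) :+ (M :+ q) :* (N :- r) := (con (+ 1) :+ con (+ 1)) :* (M :* N :- q :* r)) refl M N q r)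
      (+-pos (*-pos p₁ r₂) (*-pos p₂ r₁))) ,
    *-cancelˡ-pos (+-pos 0<1 0<1) (<-respʳ
      (solve 4 (λ M N q r → (M :- q) :* (N :- r) :+ (M :+ q) :* (N :+ r) := (con (+ 1) :+ con (+ 1)) :* (M :* N :+ q :* r)) refl M N q r)
      (+-pos (*-pos p₁ r₁) (*-pos p₂ r₂)))

  bounded : ∀ q → ∃ λ M → Within M q
  bounded q with archimedean q | archimedean (- q)
  ... | m , q<m | n , -q<n = m · 1# + n · 1# ,
    <-respʳ (solve 3 (λ m n q → m :- q :+ n := m :+ n :- q) refl (m · 1#) (n · 1#) q) (pos+nonNeg (x<y⇒0<y-x q<m) (0≤n·1 n)) ,
    <-respʳ (solve 3 (λ m n q → n :- :- q :+ m := m :+ n :+ q) refl (m · 1#) (n · 1#) q) (pos+nonNeg (x<y⇒0<y-x -q<n) (0≤n·1 m))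

  -- Continuity at one point in division-free form: the difference quotient is supplied as data, so
  -- sums and products with `x` are handled by polynomial identities.
  record Lipschitz (g : Carrier → Carrier) (x : Carrier) : Set (c ⊔ ℓ₁ ⊔ ℓ₃) where
    constructor lipschitz
    field
      bound    : Carrier
      quotient : ∀ h → Within 1# h → ∃ λ q → g (x + h) ≈ g x + h * q × Within bound q

  lipschitz-const : ∀ k x → Lipschitz (λ _ → k) x
  lipschitz-const k x = lipschitz 1# λ h _ → 0# , solve 2 (λ k h → k := k :+ h :* con (+ 0)) refl k h ,
    <-respʳ (solve 0 (con (+ 1) := con (+ 1) :- con (+ 0)) refl) 0<1 ,
    <-respʳ (solve 0 (con (+ 1) := con (+ 1) :+ con (+ 0)) refl) 0<1

  lipschitz-+ : ∀ {f g x} → Lipschitz f x → Lipschitz g x → Lipschitz (λ x → f x + g x) x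
  lipschitz-+ {f} {g} {x} (lipschitz M F) (lipschitz N G) = lipschitz (M + N) λ h ∣h∣<1 →
    let (q , eq , q<) = F h ∣h∣<1 ; (r , er , r<) = G h ∣h∣<1 in
    q + r ,
    trans (+-cong eq er) (solve 5 (λ f g h q r → (f :+ h :* q) :+ (g :+ h :* r) := f :+ g :+ h :* (q :+ r)) refl (f x) (g x) h q r) ,
    within-+ q< r<

  lipschitz-scale : ∀ {g x} k → Lipschitz g x → Lipschitz (λ x → k * g x) x
  lipschitz-scale {g} {x} k (lipschitz M G) = let (K , k<) = bounded k in lipschitz (K * M) λ h ∣h∣<1 →
    let (q , eq , q<) = G h ∣h∣<1 in
    k * q ,
    trans (*-congˡ eq) (solve 4 (λ g k h q → k :* (g :+ h :* q) := k :* g :+ h :* (k :* q)) refl (g x) k h q) ,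
    within-* k< q<

  lipschitz-x* : ∀ {g x} → Lipschitz g x → Lipschitz (λ x → x * g x) x
  -- `X + 1#` bounds the shifted argument `x + h`.
  lipschitz-x* {g} {x} (lipschitz M G) = let (K , g<) = bounded (g x) ; (X , x<) = bounded x in lipschitz (K + (X + 1#) * M) λ h ∣h∣<1 →
    let (q , eq , q<) = G h ∣h∣<1 in
    g x + (x + h) * q ,
    trans (*-congˡ eq) (solve 4 (λ x g h q → (x :+ h) :* (g :+ h :* q) := x :* g :+ h :* (g :+ (x :+ h) :* q)) refl x (g x) h q) ,
    within-+ g< (within-* (within-+ x< ∣h∣<1) q<)

  lipschitz-A : ∀ n x → Lipschitz (A n) x
  lipschitz-B : ∀ n x → Lipschitz (B n) x
  lipschitz-A zero    x = lipschitz-const 1# x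
  lipschitz-A (suc n) x = lipschitz-+ (lipschitz-x* (lipschitz-A n x)) (lipschitz-scale (y n) (lipschitz-B n x))
  lipschitz-B zero    x = lipschitz-const 0# x
  lipschitz-B (suc n) x = lipschitz-+ (lipschitz-x* (lipschitz-B n x)) (lipschitz-scale (- y n) (lipschitz-A n x))

  -- The change of `g` is smaller than `M * δ`, which is below `g x` for late `n`. The left
  -- neighbours serve openness of `Pos`, the right ones the sign of `A` at the cut.
  lipschitz-pos : ∀ {g x} → Lipschitz g x → 0# < g x →
    Eventually (λ n → 0# < g (x + 1/ suc n) × 0# < g (x - 1/ suc n))
  lipschitz-pos {g} {x} (lipschitz M G) 0<g = proj₁ small , λ n N≤n → nearby (1/ suc n) (0<1/ n) (proj₂ small n N≤n)
    where
    small = eventually-× (1/-small 1# 0<1) (1/-small M 0<g)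
    nearby : ∀ δ → 0# < δ → 1# * δ < 1# × M * δ < g x → 0# < g (x + δ) × 0# < g (x - δ)
    nearby δ 0<δ (δ<1 , Mδ<g) = up (G δ (1-δ , 1+δ)) , down (G (- δ) (1--δ , 1-δ))
      where
      1-δ : 0# < 1# - δ
      1-δ = <-respʳ (+-congˡ (-‿cong (*-identityˡ δ))) (x<y⇒0<y-x δ<1)
      1+δ : 0# < 1# + δ
      1+δ = +-pos 0<1 0<δ
      1--δ : 0# < 1# - - δ
      1--δ = <-respʳ (solve 1 (λ d → con (+ 1) :+ d := con (+ 1) :- :- d) refl δ) 1+δ
      up : ∃ (λ q → g (x + δ) ≈ g x + δ * q × Within M q) → 0# < g (x + δ)
      up (q , eq , _ , M+q) = <-respʳ (trans
        (solve 4 (λ g M d q → g :- M :* d :+ d :* (M :+ q) := g :+ d :* q) refl (g x) M δ q) (sym eq))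
        (+-pos (x<y⇒0<y-x Mδ<g) (*-pos 0<δ M+q))
      down : ∃ (λ q → g (x - δ) ≈ g x + - δ * q × Within M q) → 0# < g (x - δ)
      down (q , eq , M-q , _) = <-respʳ (trans
        (solve 4 (λ g M d q → g :- M :* d :+ d :* (M :- q) := g :+ :- d :* q) refl (g x) M δ q) (sym eq))
        (+-pos (x<y⇒0<y-x Mδ<g) (*-pos 0<δ M-q))

  Pos-open : ∀ n → Pos n x → Eventually (λ k → Pos n (x - 1/ suc k))
  Pos-open     zero    _       = 0 , λ _ _ → tt
  Pos-open {x} (suc n) (p , q) = proj₁ near , λ k N≤k →
    proj₁ (proj₂ near k N≤k) , proj₂ (proj₂ (proj₂ near k N≤k))
    where near = eventually-× (Pos-open n p) (lipschitz-pos (lipschitz-A (suc n) x) q)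

  -- The supremum of the x that are not Pos is a zero of A: there A cannot be
  -- negative, and were it positive, then so would be all the preceding A k.
  cut-isRoot : ∀ d {α} → (∀ {x} → α < x → Pos (suc d) x) → (∀ {x} → x < α → ¬ Pos (suc d) x) → A (suc d) α ≈ 0#
  cut-isRoot d {α} above below = nonNeg∧nonPos⇒≈0 (0≤A ℕ.≤-refl) λ 0<A → ¬Pos (proj₁ (Pos-α d ℕ.≤-refl) , 0<A)
    where
    α<α+1/n : ∀ n → α < α + 1/ suc n
    α<α+1/n n = 0<y-x⇐ (solve 2 (λ a d → d := a :+ d :- a) refl α (1/ suc n)) (0<1/ n)

    α-1/n<α : ∀ n → α - 1/ suc n < α
    α-1/n<α n = 0<y-x⇐ (solve 2 (λ a d → d := a :- (a :- d)) refl α (1/ suc n)) (0<1/ n)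

    ¬Pos : ¬ Pos (suc d) α
    ¬Pos p = let (n , q) = witness (Pos-open (suc d) p) in below (α-1/n<α n) q

    -- A negative value would persist at some point just right of `α`, where `Pos` holds.
    0≤A : ∀ {k} → k ℕ.≤ suc d → 0# ≤ A k α
    0≤A {k} k≤d A<0 =
      let (n , -A>0 , _) = witness (lipschitz-pos (lipschitz-scale (- 1#) (lipschitz-A k α))
            (<-respʳ (solve 1 (λ a → :- a := (:- con (+ 1)) :* a) refl (A k α)) (x<0⇒0<-x A<0)))
      in <-irrefl
      (solve 1 (λ a → con (+ 0) := a :+ (:- con (+ 1)) :* a) refl (A k (α + 1/ suc n)))
      (+-pos (Pos⇒0<A k (Pos-≤ (ℕ.≤⇒≤′ k≤d) (above (α<α+1/n n)))) -A>0)

    0≤α : 0# ≤ α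
    0≤α = nonNeg-resp (A₁≈x α) (0≤A (ℕ.s≤s ℕ.z≤n))

    -- Strict negativity of `B` is carried along to upgrade the weak inequalities: `α * A (suc k) α`
    -- is the nonnegative next value of `A` plus a positive multiple of `- B (suc k) α`, which
    -- forces both `A (suc k) α` and `α` to be positive.
    Pos-α : ∀ k → k ℕ.< suc d → Pos k α × 0# < - B (suc k) α
    Pos-α zero _ = tt , <-respʳ
      (solve 2 (λ α y → y := :- (α :* con (+ 0) :+ :- y :* con (+ 1))) refl α (y 0)) (0<y 0)
    Pos-α (suc k) k<d with Pos-α k (ℕ.<-trans (ℕ.n<1+n k) k<d)
    ... | p , 0<-B = (p , 0<A) , <-respʳ (-B-suc (suc k) α) (+-pos (*-pos 0<α 0<-B) (*-pos (0<y (suc k)) 0<A))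
      where
      0<αA : 0# < α * A (suc k) α
      0<αA = <-respʳ (solve 4 (λ x a y b → (x :* a :+ y :* b) :+ y :* (:- b) := x :* a) refl α (A (suc k) α) (y (suc k)) (B (suc k) α))
        (nonNeg+pos (0≤A k<d) (*-pos (0<y (suc k)) 0<-B))
      0<A : 0# < A (suc k) α
      0<A = 0<xy⇒0<y (0≤A (ℕ.<⇒≤ k<d)) 0<αA
      0<α : 0# < α
      0<α = 0<xy⇒0<y 0≤α (<-respʳ (*-comm _ _) 0<αA)

  -- The index is a successor because `Pos 0` holds everywhere and would leave no point below the
  -- cut.
  largestRoot : ∀ d → ∃ λ α → A (suc d) α ≈ 0# × (∀ {x} → α < x → Pos (suc d) x)
  largestRoot d =
    let (α , above , below) = cut (Pos (suc d)) (Pos-upward (suc d)) (Pos-located (suc d)) (0# , ¬Pos-0 d) (Pos-inhabited (suc d))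
    in α , cut-isRoot d above below , above

-- From the generating function to the binomial expansion

module HStar {c ℓ : Level} (R : CommutativeRing c ℓ) where
  open CommutativeRing R hiding (zero)
  open IntegerSolver R using (solve; con; _:=_; _:+_; _:*_; _:-_; :-_)
  open SemiringMult semiring using (×-homo-+; ×1-homo-*) renaming (_×_ to _·_)
  open SemiringSum semiring using (sum; sum-cong-≋; *-distribˡ-sum)
  open RawSemiringDefs (RawRing.rawSemiring rawRing) using (product)
  open SetoidReasoning setoid

  ι : ℕ → Carrier
  ι n = n · 1#

  -- This is n! times the binomial coefficient, which makes sense in any commutative ring without
  -- dividing by n!.
  falling : Carrier → ℕ → Carrier
  falling x zero    = 1#
  falling x (suc n) = x * falling (x - 1#) n

  falling-cong : ∀ n {x y} → x ≈ y → falling x n ≈ falling y n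
  falling-cong zero    x≈y = refl
  falling-cong (suc n) x≈y = *-cong x≈y (falling-cong n (+-congʳ x≈y))

  product≈falling : ∀ x n → product {n} (λ j → x - ι (toℕ j)) ≈ falling x n
  product≈falling x n = trans (shifted n 0) (falling-cong n (solve 1 (λ x → x :- con (+ 0) := x) refl x))
    where
    shifted : ∀ n k → product {n} (λ j → x - ι (k ℕ.+ toℕ j)) ≈ falling (x - ι k) n
    shifted zero    k = refl
    shifted (suc n) k = *-cong (reflexive (≡.cong (λ m → x - ι m) (ℕ.+-identityʳ k)))
      (trans (product-cong n (λ j → reflexive (≡.cong (λ m → x - ι m) (ℕ.+-suc k (toℕ j)))))
        (trans (shifted n (suc k))
          (falling-cong n (solve 2 (λ x k → x :- (con (+ 1) :+ k) := x :- k :- con (+ 1)) refl x (ι k)))))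
      where
      product-cong : ∀ n {f g : Fin n → Carrier} → (∀ j → f j ≈ g j) → product f ≈ product g
      product-cong zero    eq = refl
      product-cong (suc n) eq = *-cong (eq Fin.zero) (product-cong n (eq ∘ Fin.suc))

  falling-+ : ∀ m n x → falling x (m ℕ.+ n) ≈ falling x m * falling (x - ι m) n
  falling-+ zero    n x = sym (trans (*-identityˡ _) (falling-cong n (solve 1 (λ x → x :- con (+ 0) := x) refl x)))
  falling-+ (suc m) n x = trans
    (*-congˡ (trans (falling-+ m n (x - 1#))
      (*-congˡ (falling-cong n (solve 2 (λ x m → x :- con (+ 1) :- m := x :- (con (+ 1) :+ m)) refl x (ι m))))))
    (sym (*-assoc _ _ _))

  falling-last : ∀ n x → falling x (suc n) ≈ falling x n * (x - ι n)
  falling-last n x = trans (reflexive (≡.cong (falling x) (ℕ.+-comm 1 n)))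
    (trans (falling-+ n 1 x) (*-congˡ (*-identityʳ _)))

  falling-pascal : ∀ n x → falling (1# + x) (suc n) ≈ ι (suc n) * falling x n + falling x (suc n)
  falling-pascal n x = begin
    (1# + x) * falling (1# + x - 1#) n          ≈⟨ *-congˡ (falling-cong n (solve 1 (λ x → con (+ 1) :+ x :- con (+ 1) := x) refl x)) ⟩
    (1# + x) * falling x n                      ≈⟨ solve 3 (λ x n f → (con (+ 1) :+ x) :* f := (con (+ 1) :+ n) :* f :+ f :* (x :- n)) refl x (ι n) (falling x n) ⟩
    ι (suc n) * falling x n + falling x n * (x - ι n) ≈⟨ +-congˡ (falling-last n x) ⟨
    ι (suc n) * falling x n + falling x (suc n)      ∎

  falling-zero : ∀ {m n} → m ℕ.< n → falling (ι m) n ≈ 0#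
  falling-zero {zero}  {suc n} _           = zeroˡ _
  falling-zero {suc m} {suc n} (ℕ.s≤s m<n) = trans
    (*-congˡ (trans (falling-cong n (solve 1 (λ x → con (+ 1) :+ x :- con (+ 1) := x) refl (ι m))) (falling-zero m<n)))
    (zeroʳ _)

  -- Cauchy products and backward differences

  infix 4 _≋_
  _≋_ : (u v : ℕ → Carrier) → Set ℓ
  u ≋ v = ∀ n → u n ≈ v n

  -- Over the complex numbers this agrees by definition with `_*ₛ_`, as `oneMinusT^` exploits.
  conv : (u v : ℕ → Carrier) → ℕ → Carrier
  conv u v n = sum {suc n} (λ i → u (toℕ i) * v (n ∸ toℕ i))

  conv-cong : ∀ {u u′ v v′} → u ≋ u′ → v ≋ v′ → conv u v ≋ conv u′ v′
  conv-cong u≋ v≋ n = sum-cong-≋ {suc n} (λ i → *-cong (u≋ (toℕ i)) (v≋ (n ∸ toℕ i)))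

  -- Multiplication of a power series by 1 - t.
  ∇ : (ℕ → Carrier) → ℕ → Carrier
  ∇ u zero    = u zero
  ∇ u (suc n) = u (suc n) - u n

  ∇^ : ℕ → (ℕ → Carrier) → ℕ → Carrier
  ∇^ zero    u = u
  ∇^ (suc k) u = ∇ (∇^ k u)

  ∇-cong : ∀ {u v} → u ≋ v → ∇ u ≋ ∇ v
  ∇-cong u≋v zero    = u≋v zero
  ∇-cong u≋v (suc n) = +-cong (u≋v (suc n)) (-‿cong (u≋v n))

  ∇^-cong : ∀ k {u v} → u ≋ v → ∇^ k u ≋ ∇^ k v
  ∇^-cong zero    u≋v = u≋v
  ∇^-cong (suc k) u≋v = ∇-cong (∇^-cong k u≋v)

  ∇^-inner : ∀ k u → ∇^ (suc k) u ≋ ∇^ k (∇ u)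
  ∇^-inner zero    u n = refl
  ∇^-inner (suc k) u = ∇-cong (∇^-inner k u)

  ∇-scale : ∀ a u → ∇ (λ n → a * u n) ≋ (λ n → a * ∇ u n)
  ∇-scale a u zero    = refl
  ∇-scale a u (suc n) = solve 3 (λ a x y → a :* x :- a :* y := a :* (x :- y)) refl a (u (suc n)) (u n)

  ∇^-scale : ∀ k a u → ∇^ k (λ n → a * u n) ≋ (λ n → a * ∇^ k u n)
  ∇^-scale zero    a u n = refl
  ∇^-scale (suc k) a u n = trans (∇-cong (∇^-scale k a u) n) (∇-scale a (∇^ k u) n)

  -- Powers of 1 - t have constant term 1. This is what identifies `h* 0` with the value of `f` at
  -- zero.
  ∇^-zero : ∀ k u → ∇^ k u zero ≈ u zero
  ∇^-zero zero    u = refl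
  ∇^-zero (suc k) u = ∇^-zero k u

  conv-minusˡ : ∀ u u′ v n → conv (λ i → u i - u′ i) v n ≈ conv u v n - conv u′ v n
  conv-minusˡ u u′ v zero = solve 3 (λ a b v → (a :- b) :* v :+ con (+ 0) := (a :* v :+ con (+ 0)) :- (b :* v :+ con (+ 0)))
    refl (u 0) (u′ 0) (v 0)
  conv-minusˡ u u′ v (suc n) = trans (+-congˡ (conv-minusˡ (u ∘ suc) (u′ ∘ suc) v n))
    (solve 5 (λ a b v x y → (a :- b) :* v :+ (x :- y) := (a :* v :+ x) :- (b :* v :+ y))
      refl (u 0) (u′ 0) (v (suc n)) (conv (u ∘ suc) v n) (conv (u′ ∘ suc) v n))

  -- With `conv-∇ʳ`, this lets a factor 1 - t move freely between the two arguments of a Cauchy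
  -- product.
  conv-∇ˡ : ∀ u v → conv (∇ u) v ≋ ∇ (conv u v)
  conv-∇ˡ u v zero    = refl
  conv-∇ˡ u v (suc n) = trans (+-congˡ (conv-minusˡ (u ∘ suc) u v n)) (sym (+-assoc _ _ _))

  conv-∇ʳ : ∀ u v → conv u (∇ v) ≋ ∇ (conv u v)
  conv-∇ʳ u v zero          = refl
  conv-∇ʳ u v (suc zero)    = trans (+-congˡ (conv-∇ʳ (u ∘ suc) v 0))
    (solve 4 (λ u v v′ x → u :* (v′ :- v) :+ x := (u :* v′ :+ x) :- (u :* v :+ con (+ 0)))
      refl (u 0) (v 0) (v 1) (conv (u ∘ suc) v 0))
  conv-∇ʳ u v (suc (suc n)) = trans (+-congˡ (conv-∇ʳ (u ∘ suc) v (suc n)))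
    (solve 5 (λ u v v′ x y → u :* (v′ :- v) :+ (x :- y) := (u :* v′ :+ x) :- (u :* v :+ y))
      refl (u 0) (v (suc n)) (v (suc (suc n))) (conv (u ∘ suc) v (suc n)) (conv (u ∘ suc) v n))

  conv-∇^ˡ : ∀ k u v → conv (∇^ k u) v ≋ ∇^ k (conv u v)
  conv-∇^ˡ zero    u v n = refl
  conv-∇^ˡ (suc k) u v n = trans (conv-∇ˡ (∇^ k u) v n) (∇-cong (conv-∇^ˡ k u v) n)

  conv-∇^ʳ : ∀ k u v → conv u (∇^ k v) ≋ ∇^ k (conv u v)
  conv-∇^ʳ zero    u v n = refl
  conv-∇^ʳ (suc k) u v n = trans (conv-∇ʳ u (∇^ k v) n) (∇-cong (conv-∇^ʳ k u v) n)

  conv-zeroˡ : ∀ {u} → (∀ n → u n ≈ 0#) → ∀ v n → conv u v n ≈ 0#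
  conv-zeroˡ u≈0 v zero    = trans (+-congʳ (trans (*-congʳ (u≈0 0)) (zeroˡ _))) (+-identityˡ _)
  conv-zeroˡ u≈0 v (suc n) = trans (+-cong (trans (*-congʳ (u≈0 0)) (zeroˡ _)) (conv-zeroˡ (u≈0 ∘ suc) v n)) (+-identityˡ _)

  δ₀ : ℕ → Carrier
  δ₀ zero    = 1#
  δ₀ (suc _) = 0#

  conv-δ₀ˡ : ∀ v → conv δ₀ v ≋ v
  conv-δ₀ˡ v zero    = solve 1 (λ v → con (+ 1) :* v :+ con (+ 0) := v) refl (v 0)
  conv-δ₀ˡ v (suc n) = trans (+-cong (*-identityˡ _) (conv-zeroˡ (λ _ → refl) v n)) (+-identityʳ _)

  conv-δ₀ʳ : ∀ a u → conv u (λ n → a * δ₀ n) ≋ (λ n → a * u n)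
  conv-δ₀ʳ a u zero    = solve 2 (λ a u → u :* (a :* con (+ 1)) :+ con (+ 0) := a :* u) refl a (u 0)
  conv-δ₀ʳ a u (suc n) = trans (+-congˡ (conv-δ₀ʳ a (u ∘ suc) n))
    (solve 3 (λ a u x → u :* (a :* con (+ 0)) :+ x := x) refl a (u 0) (a * u (suc n)))

  -- d! times the coefficients of 1/(1 - t)^(d+1).
  rising : ℕ → ℕ → Carrier
  rising d k = falling (ι (k ℕ.+ d)) d

  ∇-rising : ∀ d → ∇ (rising (suc d)) ≋ (λ k → ι (suc d) * rising d k)
  ∇-rising d zero = trans (falling-pascal d (ι d)) (trans (+-congˡ (falling-zero (ℕ.n<1+n d))) (+-identityʳ _))
  ∇-rising d (suc k) = begin
    falling (1# + ι (k ℕ.+ suc d)) (suc d) - falling (ι (k ℕ.+ suc d)) (suc d)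
      ≈⟨ +-congʳ (falling-pascal d (ι (k ℕ.+ suc d))) ⟩
    ι (suc d) * falling (ι (k ℕ.+ suc d)) d + falling (ι (k ℕ.+ suc d)) (suc d) - falling (ι (k ℕ.+ suc d)) (suc d)
      ≈⟨ solve 2 (λ x y → x :+ y :- y := x) refl _ _ ⟩
    ι (suc d) * falling (ι (k ℕ.+ suc d)) d
      ≡⟨ ≡.cong (λ m → ι (suc d) * falling (ι m) d) (ℕ.+-suc k d) ⟩
    ι (suc d) * falling (ι (suc k ℕ.+ d)) d
      ∎

  ∇^-rising : ∀ d → ∇^ (suc d) (rising d) ≋ (λ n → ι (d !) * δ₀ n)
  ∇^-rising zero zero    = solve 0 (con (+ 1) := (con (+ 1) :+ con (+ 0)) :* con (+ 1)) refl
  ∇^-rising zero (suc n) = solve 0 (con (+ 1) :- con (+ 1) := (con (+ 1) :+ con (+ 0)) :* con (+ 0)) refl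
  ∇^-rising (suc d) n = begin
    ∇^ (suc (suc d)) (rising (suc d)) n              ≈⟨ ∇^-inner (suc d) (rising (suc d)) n ⟩
    ∇^ (suc d) (∇ (rising (suc d))) n                ≈⟨ ∇^-cong (suc d) (∇-rising d) n ⟩
    ∇^ (suc d) (λ k → ι (suc d) * rising d k) n      ≈⟨ ∇^-scale (suc d) (ι (suc d)) (rising d) n ⟩
    ι (suc d) * ∇^ (suc d) (rising d) n              ≈⟨ *-congˡ (∇^-rising d n) ⟩
    ι (suc d) * (ι (d !) * δ₀ n)                     ≈⟨ *-assoc _ _ _ ⟨
    ι (suc d) * ι (d !) * δ₀ n                       ≈⟨ *-congʳ (×1-homo-* (suc d) (d !)) ⟨
    ι (suc d !) * δ₀ n                               ∎

  -- Division by the power of 1 - t: the differences move from `F` to `rising d`, where only the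
  -- constant term d! survives.
  ∇^-inverse : ∀ d F {h} → ∇^ (suc d) F ≋ h → ∀ n → conv h (rising d) n ≈ ι (d !) * F n
  ∇^-inverse d F {h} ∇F≋h n = begin
    conv h (rising d) n                    ≈⟨ conv-cong {v = rising d} ∇F≋h (λ _ → refl) n ⟨
    conv (∇^ (suc d) F) (rising d) n       ≈⟨ conv-∇^ˡ (suc d) F (rising d) n ⟩
    ∇^ (suc d) (conv F (rising d)) n       ≈⟨ conv-∇^ʳ (suc d) F (rising d) n ⟨
    conv F (∇^ (suc d) (rising d)) n       ≈⟨ conv-cong {u = F} (λ _ → refl) (∇^-rising d) n ⟩
    conv F (λ n → ι (d !) * δ₀ n) n        ≈⟨ conv-δ₀ʳ (ι (d !)) F n ⟩
    ι (d !) * F n                          ∎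

  sum-zero : ∀ n {T : Fin n → Carrier} → (∀ i → T i ≈ 0#) → sum T ≈ 0#
  sum-zero zero    _   = refl
  sum-zero (suc n) T≈0 = trans (+-cong (T≈0 Fin.zero) (sum-zero n (T≈0 ∘ Fin.suc))) (+-identityˡ _)

  sum-extend : ∀ m k {T : ℕ → Carrier} → (∀ i → m ℕ.< i → T i ≈ 0#) →
    sum {suc m} (T ∘ toℕ) ≈ sum {suc (m ℕ.+ k)} (T ∘ toℕ)
  sum-extend zero    k T≈0 = +-congˡ (sym (sum-zero k (λ i → T≈0 (suc (toℕ i)) (ℕ.s≤s ℕ.z≤n))))
  sum-extend (suc m) k T≈0 = +-congˡ (sum-extend m k (λ i m<i → T≈0 (suc i) (ℕ.s≤s m<i)))

  ι-∸ : ∀ {m n} → m ℕ.≤ n → ι (n ∸ m) ≈ ι n - ι m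
  ι-∸ {m} {n} m≤n = begin
    ι (n ∸ m)                ≈⟨ solve 2 (λ a b → a := b :+ a :- b) refl (ι (n ∸ m)) (ι m) ⟩
    ι m + ι (n ∸ m) - ι m    ≈⟨ +-congʳ (×-homo-+ 1# m (n ∸ m)) ⟨
    ι (m ℕ.+ (n ∸ m)) - ι m  ≡⟨ ≡.cong (λ k → ι k - ι m) (ℕ.m+[n∸m]≡n m≤n) ⟩
    ι n - ι m                ∎

  expansion : ℕ → (ℕ → Carrier) → Carrier → Carrier
  expansion d h z = sum {suc d} (λ i → h (toℕ i) * falling (z + ι d - ι (toℕ i)) d)

  -- The Cauchy product stops at `k`, the expansion at `d`; both extend to `k + d`. Terms beyond `d`
  -- vanish with `h`. Those with k < i ≤ d vanish because k + d - i is a natural number less than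
  -- `d`, so its falling factorial contains the factor zero.
  conv-rising : ∀ d {h} → (∀ i → d ℕ.< i → h i ≈ 0#) → ∀ k → conv h (rising d) k ≈ expansion d h (ι k)
  conv-rising d {h} h≈0 k = begin
    conv h (rising d) k               ≈⟨ sum-cong-≋ {suc k} (λ i → *-congˡ {h (toℕ i)} (falling-cong d (argument (ℕ.≤-pred (toℕ<n i))))) ⟩
    sum {suc k} (T ∘ toℕ)             ≈⟨ sum-extend k d T≈0ᵏ ⟩
    sum {suc (k ℕ.+ d)} (T ∘ toℕ)     ≡⟨ ≡.cong (λ m → sum {suc m} (T ∘ toℕ)) (ℕ.+-comm k d) ⟩
    sum {suc (d ℕ.+ k)} (T ∘ toℕ)     ≈⟨ sum-extend d k T≈0ᵈ ⟨
    sum {suc d} (T ∘ toℕ)             ∎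
    where
    T : ℕ → Carrier
    T i = h i * falling (ι k + ι d - ι i) d

    argument : ∀ {i} → i ℕ.≤ k → ι (k ∸ i ℕ.+ d) ≈ ι k + ι d - ι i
    argument {i} i≤k = begin
      ι (k ∸ i ℕ.+ d)     ≈⟨ ×-homo-+ 1# (k ∸ i) d ⟩
      ι (k ∸ i) + ι d     ≈⟨ +-congʳ (ι-∸ i≤k) ⟩
      ι k - ι i + ι d     ≈⟨ solve 3 (λ k i d → k :- i :+ d := k :+ d :- i) refl (ι k) (ι i) (ι d) ⟩
      ι k + ι d - ι i     ∎

    T≈0ᵈ : ∀ i → d ℕ.< i → T i ≈ 0#
    T≈0ᵈ i d<i = trans (*-congʳ (h≈0 i d<i)) (zeroˡ _)

    T≈0ᵏ : ∀ i → k ℕ.< i → T i ≈ 0#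
    T≈0ᵏ i k<i with d ℕ.<? i
    ... | yes d<i = T≈0ᵈ i d<i
    ... | no  d≮i = trans (*-congˡ (trans (falling-cong d (sym eq)) (falling-zero k+d∸i<d))) (zeroʳ _)
      where
      i≤d = ℕ.≮⇒≥ d≮i
      eq : ι (k ℕ.+ (d ∸ i)) ≈ ι k + ι d - ι i
      eq = trans (×-homo-+ 1# k (d ∸ i)) (trans (+-congˡ (ι-∸ i≤d)) (sym (+-assoc _ _ _)))
      k+d∸i<d : k ℕ.+ (d ∸ i) ℕ.< d
      k+d∸i<d = ≡.subst (k ℕ.+ (d ∸ i) ℕ.<_) (ℕ.m+[n∸m]≡n i≤d) (ℕ.+-monoˡ-< (d ∸ i) k<i)

  -- Polynomial functions in Newton form at the nodes k, k + 1, ….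
  data Newton : ℕ → (Carrier → Carrier) → Set (c ⊔ ℓ) where
    vanishing : ∀ {k f} → (∀ z → f z ≈ 0#) → Newton k f
    step : ∀ {k f} a g → (∀ z → f z ≈ a + (z - ι k) * g z) → Newton (suc k) g → Newton k f

  private variable
    k : ℕ
    f g : Carrier → Carrier

  newton-cong : (∀ z → f z ≈ g z) → Newton k f → Newton k g
  newton-cong f≈g (vanishing f≈0)       = vanishing (λ z → trans (sym (f≈g z)) (f≈0 z))
  newton-cong f≈g (step a q eq nq) = step a q (λ z → trans (sym (f≈g z)) (eq z)) nq

  newton-const : ∀ a → Newton k (λ _ → a)
  newton-const {k} a = step a (λ _ → 0#) (λ z → solve 2 (λ a x → a := a :+ x :* con (+ 0)) refl a (z - ι k)) (vanishing (λ _ → refl))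

  newton-+ : Newton k f → Newton k g → Newton k (λ z → f z + g z)
  newton-+ (vanishing f≈0) ng = newton-cong (λ z → sym (trans (+-congʳ (f≈0 z)) (+-identityˡ _))) ng
  newton-+ nf (vanishing g≈0) = newton-cong (λ z → sym (trans (+-congˡ (g≈0 z)) (+-identityʳ _))) nf
  newton-+ {k} (step a p eqp np) (step b q eqq nq) = step (a + b) (λ z → p z + q z)
    (λ z → trans (+-cong (eqp z) (eqq z))
      (solve 5 (λ a b x p q → (a :+ x :* p) :+ (b :+ x :* q) := a :+ b :+ x :* (p :+ q)) refl a b (z - ι k) (p z) (q z)))
    (newton-+ np nq)

  newton-scale : ∀ b → Newton k f → Newton k (λ z → b * f z)
  newton-scale b (vanishing f≈0) = vanishing (λ z → trans (*-congˡ (f≈0 z)) (zeroʳ b))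
  newton-scale {k} b (step a q eq nq) = step (b * a) (λ z → b * q z)
    (λ z → trans (*-congˡ (eq z))
      (solve 4 (λ a b x q → b :* (a :+ x :* q) := b :* a :+ x :* (b :* q)) refl a b (z - ι k) (q z)))
    (newton-scale b nq)

  -- Writing z + b as (k + b) + (z - k) splits off the node; falling factorials and the quadratic
  -- factors are assembled from such linear factors.
  newton-linear : ∀ b → Newton k f → Newton k (λ z → (z + b) * f z)
  newton-linear b (vanishing f≈0) = vanishing (λ z → trans (*-congˡ (f≈0 z)) (zeroʳ _))
  newton-linear {k} b (step a q eq nq) = step (a * (ι k + b)) (λ z → a + (z + b) * q z)
    (λ z → trans (*-congˡ (eq z))
      (solve 5 (λ a b k z q → (z :+ b) :* (a :+ (z :- k) :* q) := a :* (k :+ b) :+ (z :- k) :* (a :+ (z :+ b) :* q)) refl a b (ι k) z (q z)))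
    (newton-+ (newton-const a) (newton-linear b nq))

  newton-sum : ∀ n {F : Fin n → Carrier → Carrier} → (∀ i → Newton k (F i)) → Newton k (λ z → sum (λ i → F i z))
  newton-sum zero    _  = vanishing (λ _ → refl)
  newton-sum (suc n) nF = newton-+ (nF Fin.zero) (newton-sum n (nF ∘ Fin.suc))

  newton-falling : ∀ b n → Newton k (λ z → falling (z + b) n)
  newton-falling b zero    = newton-const 1#
  newton-falling b (suc n) = newton-cong
    (λ z → trans (solve 4 (λ z b n f → (z :+ (b :- n)) :* f := f :* (z :+ b :- n)) refl z b (ι n) (falling (z + b) n))
      (sym (falling-last n (z + b))))
    (newton-linear (b - ι n) (newton-falling b n))

  newton-expansion : ∀ d h → Newton k (expansion d h)
  newton-expansion d h = newton-sum (suc d) λ i → newton-scale (h (toℕ i))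
    (newton-cong (λ z → falling-cong d (sym (+-assoc z _ _))) (newton-falling (ι d - ι (toℕ i)) d))

  -- Each quadratic is decomposed as z (z + 1) + a.
  newton-quadratics : ∀ n (a : Fin n → Carrier) → Newton k f → Newton k (λ z → f z * product (λ i → z * z + z + a i))
  newton-quadratics zero    a nf = newton-cong (λ z → sym (*-identityʳ _)) nf
  newton-quadratics {f = f} (suc n) a nf = newton-cong
    (λ z → solve 4 (λ f z a p → (z :+ con (+ 0)) :* ((z :+ con (+ 1)) :* (f :* p)) :+ a :* (f :* p) := f :* ((z :* z :+ z :+ a) :* p))
      refl (f z) z (a Fin.zero) (product (λ i → z * z + z + a (Fin.suc i))))
    (newton-+ (newton-linear 0# (newton-linear 1# nfp)) (newton-scale (a Fin.zero) nfp))
    where nfp = newton-quadratics n (a ∘ Fin.suc) nf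

  module _ (torsionFree : ∀ n {x} → ι (suc n) * x ≈ 0# → x ≈ 0#) where

    -- Evaluation at the node `k` isolates the constant `a`. At a later natural `n`, the factor n -
    -- k can be cancelled, so the quotient `g` vanishes there too.
    newton-vanishes : Newton k f → (∀ n → k ℕ.≤ n → f (ι n) ≈ 0#) → ∀ z → f z ≈ 0#
    newton-vanishes (vanishing f≈0) _ = f≈0
    newton-vanishes {k} {f} (step a g eq ng) f≈0 z = begin
      f z                    ≈⟨ eq z ⟩
      a + (z - ι k) * g z    ≈⟨ +-cong a≈0 (*-congˡ (newton-vanishes ng g≈0 z)) ⟩
      0# + (z - ι k) * 0#    ≈⟨ trans (+-identityˡ _) (zeroʳ _) ⟩
      0#                     ∎
      where
      a≈0 : a ≈ 0#
      a≈0 = begin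
        a                            ≈⟨ solve 3 (λ a k g → a := a :+ (k :- k) :* g) refl a (ι k) (g (ι k)) ⟩
        a + (ι k - ι k) * g (ι k)    ≈⟨ eq (ι k) ⟨
        f (ι k)                      ≈⟨ f≈0 k ℕ.≤-refl ⟩
        0#                           ∎

      g≈0 : ∀ n → suc k ℕ.≤ n → g (ι n) ≈ 0#
      g≈0 n k<n = torsionFree (n ∸ suc k) (begin
        ι (suc (n ∸ suc k)) * g (ι n)  ≡⟨ ≡.cong (λ m → ι m * g (ι n)) (ℕ.+-∸-assoc 1 k<n) ⟨
        ι (n ∸ k) * g (ι n)            ≈⟨ *-congʳ (ι-∸ (ℕ.<⇒≤ k<n)) ⟩
        (ι n - ι k) * g (ι n)          ≈⟨ +-identityˡ _ ⟨
        0# + (ι n - ι k) * g (ι n)     ≈⟨ +-congʳ a≈0 ⟨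
        a + (ι n - ι k) * g (ι n)      ≈⟨ eq (ι n) ⟨
        f (ι n)                        ≈⟨ f≈0 n (ℕ.<⇒≤ k<n) ⟩
        0#                             ∎)

    -- Both sides are polynomial functions, so agreement at the natural numbers extends to every
    -- `z`.
    hStar-expansion : ∀ d {h} → Newton 0 f → (∀ i → d ℕ.< i → h i ≈ 0#) → ∇^ (suc d) (f ∘ ι) ≋ h →
      ∀ z → ι (d !) * f z ≈ expansion d h z
    hStar-expansion {f} d {h} nf h≈0 ∇f≋h z = begin
      ι (d !) * f z                                             ≈⟨ solve 2 (λ x y → x := y :+ (x :+ (:- con (+ 1)) :* y)) refl _ _ ⟩
      expansion d h z + (ι (d !) * f z + - 1# * expansion d h z) ≈⟨ +-congˡ (newton-vanishes difference (λ n _ → agree n) z) ⟩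
      expansion d h z + 0#                                      ≈⟨ +-identityʳ _ ⟩
      expansion d h z                                           ∎
      where
      difference : Newton 0 (λ z → ι (d !) * f z + - 1# * expansion d h z)
      difference = newton-+ (newton-scale _ nf) (newton-scale _ (newton-expansion d h))
      agree : ∀ n → ι (d !) * f (ι n) + - 1# * expansion d h (ι n) ≈ 0#
      agree n = trans (+-congʳ (trans (sym (∇^-inverse d (f ∘ ι) ∇f≋h n)) (conv-rising d h≈0 n)))
        (solve 1 (λ x → x :+ (:- con (+ 1)) :* x := con (+ 0)) refl _)

-- The commutative ring of complex numbers

module ComplexNumbers {c ℓ₁ ℓ₂ ℓ₃ : Level} (R : RealField c ℓ₁ ℓ₂ ℓ₃) where
  open OverReals R
  private
    module F = RealField R
    module O = OrderProperties R
  open O using (solve; con; _:=_; _:+_; _:*_; _:-_; :-_)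

  ℂ-commutativeRing : CommutativeRing c ℓ₁
  ℂ-commutativeRing = record
    { Carrier = ℂ ; _≈_ = _≈_ ; _+_ = _+_ ; _*_ = _*_ ; -_ = -_ ; 0# = 0ℂ ; 1# = 1ℂ
    ; isCommutativeRing = record
      { isRing = record
        { +-isAbelianGroup = record
          { isGroup = record
            { isMonoid = record
              { isSemigroup = record
                { isMagma = record
                  { isEquivalence = record
                    { refl  = F.refl , F.refl
                    ; sym   = λ (p , q) → F.sym p , F.sym q
                    ; trans = λ (p , q) (p′ , q′) → F.trans p p′ , F.trans q q′
                    }
                  ; ∙-cong = λ (p , q) (p′ , q′) → F.+-cong p p′ , F.+-cong q q′
                  }
                ; assoc = λ _ _ _ → F.+-assoc _ _ _ , F.+-assoc _ _ _
                }
              ; identity = (λ _ → F.+-identityˡ _ , F.+-identityˡ _) , (λ _ → F.+-identityʳ _ , F.+-identityʳ _)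
              }
            ; inverse = (λ _ → F.-‿inverseˡ _ , F.-‿inverseˡ _) , (λ _ → F.-‿inverseʳ _ , F.-‿inverseʳ _)
            ; ⁻¹-cong = λ (p , q) → F.-‿cong p , F.-‿cong q
            }
          ; comm = λ _ _ → F.+-comm _ _ , F.+-comm _ _
          }
        ; *-cong = λ (p , q) (p′ , q′) →
            F.+-cong (F.*-cong p p′) (F.-‿cong (F.*-cong q q′)) , F.+-cong (F.*-cong p q′) (F.*-cong q p′)
        ; *-assoc = λ (a +i b) (a′ +i b′) (a″ +i b″) →
            solve 6 (λ a b a′ b′ a″ b″ →
              (a :* a′ :+ :- (b :* b′)) :* a″ :+ :- ((a :* b′ :+ b :* a′) :* b″)
              := a :* (a′ :* a″ :+ :- (b′ :* b″)) :+ :- (b :* (a′ :* b″ :+ b′ :* a″))) F.refl a b a′ b′ a″ b″ ,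
            solve 6 (λ a b a′ b′ a″ b″ →
              (a :* a′ :+ :- (b :* b′)) :* b″ :+ (a :* b′ :+ b :* a′) :* a″
              := a :* (a′ :* b″ :+ b′ :* a″) :+ b :* (a′ :* a″ :+ :- (b′ :* b″))) F.refl a b a′ b′ a″ b″
        ; *-identity =
            (λ (a +i b) → solve 2 (λ a b → con (+ 1) :* a :+ :- (con (+ 0) :* b) := a) F.refl a b ,
                          solve 2 (λ a b → con (+ 1) :* b :+ con (+ 0) :* a := b) F.refl a b) ,
            (λ (a +i b) → solve 2 (λ a b → a :* con (+ 1) :+ :- (b :* con (+ 0)) := a) F.refl a b ,
                          solve 2 (λ a b → a :* con (+ 0) :+ b :* con (+ 1) := b) F.refl a b)
        ; distrib =
            (λ (a +i b) (a′ +i b′) (a″ +i b″) →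
              solve 6 (λ a b a′ b′ a″ b″ → a :* (a′ :+ a″) :+ :- (b :* (b′ :+ b″))
                := (a :* a′ :+ :- (b :* b′)) :+ (a :* a″ :+ :- (b :* b″))) F.refl a b a′ b′ a″ b″ ,
              solve 6 (λ a b a′ b′ a″ b″ → a :* (b′ :+ b″) :+ b :* (a′ :+ a″)
                := (a :* b′ :+ b :* a′) :+ (a :* b″ :+ b :* a″)) F.refl a b a′ b′ a″ b″) ,
            (λ (a +i b) (a′ +i b′) (a″ +i b″) →
              solve 6 (λ a b a′ b′ a″ b″ → (a′ :+ a″) :* a :+ :- ((b′ :+ b″) :* b)
                := (a′ :* a :+ :- (b′ :* b)) :+ (a″ :* a :+ :- (b″ :* b))) F.refl a b a′ b′ a″ b″ ,
              solve 6 (λ a b a′ b′ a″ b″ → (a′ :+ a″) :* b :+ (b′ :+ b″) :* a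
                := (a′ :* b :+ b′ :* a) :+ (a″ :* b :+ b″ :* a)) F.refl a b a′ b′ a″ b″)
        }
      ; *-comm = λ (a +i b) (a′ +i b′) →
          solve 4 (λ a b a′ b′ → a :* a′ :+ :- (b :* b′) := a′ :* a :+ :- (b′ :* b)) F.refl a b a′ b′ ,
          solve 4 (λ a b a′ b′ → a :* b′ :+ b :* a′ := a′ :* b :+ b′ :* a) F.refl a b a′ b′
      }
    }

  open CommutativeRing ℂ-commutativeRing public
    using (refl; sym; trans; setoid; +-cong; +-congˡ; +-congʳ; *-cong; *-congˡ; *-congʳ; *-assoc; *-comm; *-identityˡ; *-identityʳ; zeroˡ; zeroʳ; semiring)
  module ℂ-Solver = IntegerSolver ℂ-commutativeRing

  fromℕ≈ : ∀ n → fromℕ n ≈ fromℝ (n F.· 1ᵣ)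
  fromℕ≈ zero    = refl
  fromℕ≈ (suc n) = F.+-congˡ (proj₁ (fromℕ≈ n)) , F.trans (F.+-identityˡ _) (proj₂ (fromℕ≈ n))

  fromℝ-* : ∀ x y → fromℝ x * fromℝ y ≈ fromℝ (x *ᵣ y)
  fromℝ-* x y =
    solve 2 (λ x y → x :* y :+ :- (con (+ 0) :* con (+ 0)) := x :* y) F.refl x y ,
    solve 2 (λ x y → x :* con (+ 0) :+ con (+ 0) :* y := con (+ 0)) F.refl x y

  fromℕ*1/ : ∀ n .{{_ : NonZero n}} → fromℕ n * fromℝ (1/ n) ≈ 1ℂ
  fromℕ*1/ n = trans (*-congʳ (fromℕ≈ n)) (trans (fromℝ-* _ _) (O.n*1/n≈1 n , F.refl))

  *-cancelˡ-≈0 : ∀ {u v w} → v * u ≈ 1ℂ → u * w ≈ 0ℂ → w ≈ 0ℂ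
  *-cancelˡ-≈0 {u} {v} {w} vu≈1 uw≈0 = begin
    w            ≈⟨ *-identityˡ w ⟨
    1ℂ * w       ≈⟨ *-congʳ vu≈1 ⟨
    v * u * w    ≈⟨ *-assoc v u w ⟩
    v * (u * w)  ≈⟨ *-congˡ uw≈0 ⟩
    v * 0ℂ       ≈⟨ zeroʳ v ⟩
    0ℂ           ∎
    where open SetoidReasoning setoid

  torsionFree : ∀ n {w} → fromℕ (suc n) * w ≈ 0ℂ → w ≈ 0ℂ
  torsionFree n = *-cancelˡ-≈0 (trans (*-comm _ _) (fromℕ*1/ (suc n)))

  re-sum-nonNeg : ∀ n {w : Fin n → ℂ} → (∀ i → 0ᵣ ≤ re (w i)) → 0ᵣ ≤ re (sum w)
  re-sum-nonNeg zero    _   = O.<-irrefl F.refl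
  re-sum-nonNeg (suc n) 0≤w = O.+-nonNeg (0≤w Fin.zero) (re-sum-nonNeg n (0≤w ∘ Fin.suc))

-- Evaluation on the critical line and the root bound

module CriticalLine {c ℓ₁ ℓ₂ ℓ₃ : Level} (R : RealField c ℓ₁ ℓ₂ ℓ₃) where
  open OverReals R
  open ComplexNumbers R
  open LargestRoot R
  open HStar ℂ-commutativeRing
  open SemiringExp semiring using (_^_; ^-homo-*)
  open SemiringSum semiring using (sum-cong-≋; *-distribˡ-sum)
  open SetoidReasoning setoid
  private
    module F = RealField R
    module O = OrderProperties R
  open O using (solve; con; _:=_; _:+_; _:*_; _:-_; :-_)
  module S = ℂ-Solver

  J : ℂ
  J = 0ᵣ +i 1ᵣ

  J^n-cancel : ∀ n {w} → J ^ n * w ≈ 0ℂ → w ≈ 0ℂ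
  J^n-cancel zero    p = trans (sym (*-identityˡ _)) p
  J^n-cancel (suc n) p = J^n-cancel n (*-cancelˡ-≈0 -J*J≈1 (trans (sym (*-assoc _ _ _)) p))
    where
    -J*J≈1 : (- J) * J ≈ 1ℂ
    -J*J≈1 =
      solve 0 ((:- con (+ 0)) :* con (+ 0) :+ :- ((:- con (+ 1)) :* con (+ 1)) := con (+ 1)) F.refl ,
      solve 0 ((:- con (+ 0)) :* con (+ 1) :+ (:- con (+ 1)) :* con (+ 0) := con (+ 0)) F.refl

  P P̄ : ℕ → ℝ → ℂ
  P n x = A n x +i B n x
  P̄ n x = A n x +i (-ᵣ B n x)

  P-suc : ∀ n x → P (suc n) x ≈ (x +i (-ᵣ y n)) * P n x
  P-suc n x =
    solve 4 (λ x y a b → x :* a :+ y :* b := x :* a :+ :- (:- y :* b)) F.refl x (y n) (A n x) (B n x) , F.refl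

  P̄-suc : ∀ n x → P̄ (suc n) x ≈ P̄ n x * (x +i y n)
  P̄-suc n x =
    solve 4 (λ x y a b → x :* a :+ y :* b := a :* x :+ :- (:- b :* y)) F.refl x (y n) (A n x) (B n x) ,
    solve 4 (λ x y a b → :- (x :* b :+ :- y :* a) := a :* y :+ :- b :* x) F.refl x (y n) (A n x) (B n x)

  onCL+ : ∀ n x → onCL x + fromℕ (suc n) ≈ J * (x +i (-ᵣ y n))
  onCL+ n x = trans (+-congˡ (fromℕ≈ (suc n)))
    ( F.trans (solve 3 (λ h n x → :- h :+ (con (+ 1) :+ n) := n :- h :+ con (+ 1)) F.refl O.½ (n F.· 1ᵣ) x)
        (F.trans (F.+-congˡ (F.sym O.½+½≈1))
          (solve 3 (λ h n x → n :- h :+ (h :+ h) := con (+ 0) :* x :+ :- (con (+ 1) :* :- (n :+ h))) F.refl O.½ (n F.· 1ᵣ) x))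
    , solve 2 (λ x y → x :+ con (+ 0) := con (+ 0) :* :- y :+ con (+ 1) :* x) F.refl x (y n))

  onCL- : ∀ n x → onCL x - fromℕ n ≈ J * (x +i y n)
  onCL- n x = trans (+-congˡ (CommutativeRing.-‿cong ℂ-commutativeRing (fromℕ≈ n)))
    ( solve 3 (λ h n x → :- h :- n := con (+ 0) :* x :+ :- (con (+ 1) :* (n :+ h))) F.refl O.½ (n F.· 1ᵣ) x
    , solve 2 (λ x y → x :+ :- con (+ 0) := con (+ 0) :* y :+ con (+ 1) :* x) F.refl x (y n))

  falling-above : ∀ n x → falling (onCL x + fromℕ n) n ≈ J ^ n * P n x
  falling-above zero    x = sym (*-identityˡ _)
  falling-above (suc n) x = begin
    (onCL x + fromℕ (suc n)) * falling (onCL x + fromℕ (suc n) - 1ℂ) n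
      ≈⟨ *-cong (onCL+ n x) (trans (falling-cong n (S.solve 2 (λ z n → z S.:+ (S.con (+ 1) S.:+ n) S.:- S.con (+ 1) S.:= z S.:+ n) refl (onCL x) (fromℕ n))) (falling-above n x)) ⟩
    J * (x +i (-ᵣ y n)) * (J ^ n * P n x)
      ≈⟨ S.solve 4 (λ j w k p → j S.:* w S.:* (k S.:* p) S.:= j S.:* k S.:* (w S.:* p)) refl J (x +i (-ᵣ y n)) (J ^ n) (P n x) ⟩
    J * J ^ n * ((x +i (-ᵣ y n)) * P n x)
      ≈⟨ *-congˡ (P-suc n x) ⟨
    J * J ^ n * P (suc n) x
      ∎

  falling-below : ∀ n x → falling (onCL x) n ≈ J ^ n * P̄ n x
  falling-below zero    x = trans (F.refl , solve 0 (con (+ 0) := :- con (+ 0)) F.refl) (sym (*-identityˡ _))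
  falling-below (suc n) x = begin
    falling (onCL x) (suc n)
      -- Peeling off the last factor keeps the base point on the critical line; the defining
      -- recursion would shift it to z - 1.
      ≈⟨ falling-last n (onCL x) ⟩
    falling (onCL x) n * (onCL x - fromℕ n)
      ≈⟨ *-cong (falling-below n x) (onCL- n x) ⟩
    J ^ n * P̄ n x * (J * (x +i y n))
      ≈⟨ S.solve 4 (λ j w k p → k S.:* p S.:* (j S.:* w) S.:= j S.:* k S.:* (p S.:* w)) refl J (x +i y n) (J ^ n) (P̄ n x) ⟩
    J * J ^ n * (P̄ n x * (x +i y n))
      ≈⟨ *-congˡ (P̄-suc n x) ⟨
    J * J ^ n * P̄ (suc n) x
      ∎

  -- The factors run from z + (d - i) down to z - (i - 1). Splitting them just above z leaves d - i
  -- factors for `falling-above` and i for `falling-below`.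
  falling-onCL : ∀ d i x → i ℕ.≤ d → falling (onCL x + fromℕ d - fromℕ i) d ≈ J ^ d * (P (d ∸ i) x * P̄ i x)
  falling-onCL d i x i≤d = begin
    falling w d                                    ≡⟨ ≡.cong (falling w) (ℕ.m∸n+n≡m i≤d) ⟨
    falling w (m ℕ.+ i)                            ≈⟨ falling-+ m i w ⟩
    falling w m * falling (w - fromℕ m) i               ≈⟨ *-cong (falling-cong m w≈) (falling-cong i w-m≈) ⟩
    falling (onCL x + fromℕ m) m * falling (onCL x) i   ≈⟨ *-cong (falling-above m x) (falling-below i x) ⟩
    J ^ m * P m x * (J ^ i * P̄ i x)           ≈⟨ S.solve 4 (λ a p b q → a S.:* p S.:* (b S.:* q) S.:= a S.:* b S.:* (p S.:* q)) refl (J ^ m) (P m x) (J ^ i) (P̄ i x) ⟩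
    J ^ m * J ^ i * (P m x * P̄ i x)           ≈⟨ *-congʳ (^-homo-* J m i) ⟨
    J ^ (m ℕ.+ i) * (P m x * P̄ i x)           ≡⟨ ≡.cong (λ k → J ^ k * (P m x * P̄ i x)) (ℕ.m∸n+n≡m i≤d) ⟩
    J ^ d * (P m x * P̄ i x)                   ∎
    where
    m = d ∸ i
    w = onCL x + fromℕ d - fromℕ i
    w≈ : w ≈ onCL x + fromℕ m
    w≈ = trans (S.solve 3 (λ z d i → z S.:+ d S.:- i S.:= z S.:+ (d S.:- i)) refl (onCL x) (fromℕ d) (fromℕ i)) (+-congˡ (sym (ι-∸ i≤d)))
    w-m≈ : w - fromℕ m ≈ onCL x
    w-m≈ = trans (+-congʳ w≈) (S.solve 2 (λ z m → z S.:+ m S.:- m S.:= z) refl (onCL x) (fromℕ m))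

  p₀-onCL : ∀ d x → p₀ d (onCL x) ≈ J ^ d * fromℝ (A d x +ᵣ A d x)
  p₀-onCL d x = begin
    fromℕ (d !) * (binom (onCL x + fromℕ d) d + binom (onCL x) d)
      ≈⟨ S.solve 4 (λ n r u v → n S.:* (u S.:* r S.:+ v S.:* r) S.:= n S.:* r S.:* (u S.:+ v)) refl _ _ _ _ ⟩
    fromℕ (d !) * fromℝ (1/ (d !)) * (product {d} (λ j → onCL x + fromℕ d - fromℕ (toℕ j)) + product {d} (λ j → onCL x - fromℕ (toℕ j)))
      ≈⟨ *-cong (fromℕ*1/ (d !)) (+-cong (product≈falling (onCL x + fromℕ d) d) (product≈falling (onCL x) d)) ⟩
    1ℂ * (falling (onCL x + fromℕ d) d + falling (onCL x) d)
      ≈⟨ *-identityˡ _ ⟩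
    falling (onCL x + fromℕ d) d + falling (onCL x) d
      ≈⟨ +-cong (falling-above d x) (falling-below d x) ⟩
    J ^ d * P d x + J ^ d * P̄ d x
      ≈⟨ S.solve 3 (λ j p q → j S.:* p S.:+ j S.:* q S.:= j S.:* (p S.:+ q)) refl (J ^ d) (P d x) (P̄ d x) ⟩
    J ^ d * (P d x + P̄ d x)
      ≈⟨ *-congˡ (F.refl , F.-‿inverseʳ _) ⟩
    J ^ d * fromℝ (A d x +ᵣ A d x)
      ∎
    where instance _ = d ℕ.!≢0

  A≈0⇒p₀-root : ∀ d {x} → A d x ≈ᵣ 0ᵣ → IsRoot (p₀ d) (onCL x)
  A≈0⇒p₀-root d {x} A≈0 = trans (p₀-onCL d x)
    (trans (*-congˡ (F.trans (F.+-cong A≈0 A≈0) (F.+-identityˡ _) , F.refl)) (zeroʳ _))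

  Pos⇒¬p₀-root : ∀ d {x} → Pos d x → ¬ IsRoot (p₀ d) (onCL x)
  Pos⇒¬p₀-root d {x} p root = O.<-irrefl
    (F.sym (proj₁ (J^n-cancel d (trans (sym (p₀-onCL d x)) root))))
    (O.+-pos (Pos⇒0<A d p) (Pos⇒0<A d p))

  oneMinusT^ : ∀ n → (oneMinusT ^ₛ n) ≋ ∇^ n δ₀
  oneMinusT^ zero    zero    = refl
  oneMinusT^ zero    (suc _) = refl
  oneMinusT^ (suc n) k = begin
    conv oneMinusT (oneMinusT ^ₛ n) k    ≈⟨ conv-cong {oneMinusT} {∇ δ₀} ∇δ₀ (oneMinusT^ n) k ⟩
    conv (∇ δ₀) (∇^ n δ₀) k              ≈⟨ conv-∇ˡ δ₀ (∇^ n δ₀) k ⟩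
    ∇ (conv δ₀ (∇^ n δ₀)) k              ≈⟨ ∇-cong (conv-δ₀ˡ (∇^ n δ₀)) k ⟩
    ∇^ (suc n) δ₀ k                      ∎
    where
    ∇δ₀ : oneMinusT ≋ ∇ δ₀
    ∇δ₀ zero          = refl
    ∇δ₀ (suc zero)    = S.solve 0 (S.:- S.con (+ 1) S.:= S.con (+ 0) S.:- S.con (+ 1)) refl
    ∇δ₀ (suc (suc _)) = S.solve 0 (S.con (+ 0) S.:= S.con (+ 0) S.:- S.con (+ 0)) refl

  hStar⇒∇^ : ∀ {d f h} → IsHStar d f h → ∇^ (suc d) (f ∘ fromℕ) ≋ h
  hStar⇒∇^ {d} {f} {h} isHStar n = begin
    ∇^ (suc d) F n                             ≈⟨ ∇^-cong (suc d) (conv-δ₀ˡ F) n ⟨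
    ∇^ (suc d) (conv δ₀ F) n                   ≈⟨ conv-∇^ˡ (suc d) δ₀ F n ⟨
    conv (∇^ (suc d) δ₀) F n                   ≈⟨ conv-cong {v = F} (oneMinusT^ (suc d)) (λ _ → refl) n ⟨
    conv (oneMinusT ^ₛ suc d) F n              ≈⟨ IsHStar.genFun isHStar n ⟩
    h n                                        ∎
    where F = f ∘ fromℕ

  newton-CL : ∀ {d f} → IsCLPolynomial d f → Newton 0 f
  newton-CL {d} cl = newton-cong (λ z → sym (form z)) (newton-quadratics _ (fromℝ ∘ cs) (newton-leading (parity d)))
    where
    open IsCLPolynomial cl
    newton-leading : ∀ p → Newton 0 (leadingFactor p a)
    newton-leading 0ℙ = newton-const a
    newton-leading 1ℙ = newton-scale a (newton-+ (newton-scale (fromℕ 2)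
      (newton-cong (λ z → S.solve 1 (λ z → (z S.:+ S.con (+ 0)) S.:* S.con (+ 1) S.:= z) refl z)
        (newton-linear 0ℂ (newton-const 1ℂ))))
      (newton-const 1ℂ))

  -- At zero the quadratics reduce to the constants `cs i` and the leading factor to `a`. The
  -- product of the constants is a positive real and hence has an explicit inverse, so a zero value
  -- would give `a ≈ 0ℂ`.
  CL-nonzero-at-0 : ∀ {d f} → IsCLPolynomial d f → ¬ f 0ℂ ≈ 0ℂ
  CL-nonzero-at-0 {d} {f} cl f0≈0 = a≉0 (*-cancelˡ-≈0 (trans (*-comm _ _) C*C⁻¹≈1)
    (trans (sym (trans (form 0ℂ) (trans (*-cong (leading (parity d)) (proj₁ (proj₂ prod))) (*-comm _ _)))) f0≈0))
    where
    open IsCLPolynomial cl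
    leading : ∀ p → leadingFactor p a 0ℂ ≈ a
    leading 0ℙ = refl
    leading 1ℙ = S.solve 2 (λ a n → a S.:* (n S.:* S.con (+ 0) S.:+ S.con (+ 1)) S.:= a) refl a (fromℕ 2)

    product-pos : ∀ n (b : Fin n → ℝ) → (∀ i → 1/ 4 ≤ b i) →
      ∃ λ C → product (λ i → 0ℂ * 0ℂ + 0ℂ + fromℝ (b i)) ≈ fromℝ C × 0ᵣ < C
    product-pos zero    b b≥¼ = 1ᵣ , refl , F.0<1
    product-pos (suc n) b b≥¼ =
      let (C , eq , 0<C) = product-pos n (b ∘ Fin.suc) (b≥¼ ∘ Fin.suc) in
      b Fin.zero *ᵣ C ,
      trans (*-cong (S.solve 1 (λ b → S.con (+ 0) S.:* S.con (+ 0) S.:+ S.con (+ 0) S.:+ b S.:= b) refl (fromℝ (b Fin.zero))) eq) (fromℝ-* _ _) ,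
      -- The lower bound is a negated inequality; comparing the constant with the gap from 0 to ¼
      -- makes it strictly positive.
      F.*-pos ([ (λ 0<b → 0<b) , (λ b<¼ → contradiction b<¼ (b≥¼ Fin.zero)) ]′ (O.<-cotrans (O.0<1/ 3) (b Fin.zero))) 0<C

    prod = product-pos _ cs cs≥¼
    C*C⁻¹≈1 : fromℝ (proj₁ prod) * fromℝ (proj₁ (O.inverse (proj₂ (proj₂ prod)))) ≈ 1ℂ
    C*C⁻¹≈1 = trans (fromℝ-* _ _) (proj₂ (O.inverse (proj₂ (proj₂ prod))) , F.refl)

  expansion-onCL : ∀ d h x → expansion d h (onCL x) ≈ J ^ d * sum {suc d} (λ i → h (toℕ i) * (P (d ∸ toℕ i) x * P̄ (toℕ i) x))
  expansion-onCL d h x = trans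
    (sum-cong-≋ {suc d} (λ i → trans (*-congˡ {h (toℕ i)} (falling-onCL d (toℕ i) x (ℕ.≤-pred (toℕ<n i))))
      (S.solve 3 (λ h j p → h S.:* (j S.:* p) S.:= j S.:* (h S.:* p)) refl (h (toℕ i)) (J ^ d) (P (d ∸ toℕ i) x * P̄ (toℕ i) x))))
    (sym (*-distribˡ-sum {suc d} (J ^ d) (λ i → h (toℕ i) * (P (d ∸ toℕ i) x * P̄ (toℕ i) x))))

  Pos⇒¬root : ∀ {d f x} → IsCLPolynomial d f → Diamond d f → Pos d x → ¬ IsRoot f (onCL x)
  Pos⇒¬root {d} {f} {x} cl diamond p root = CL-nonzero-at-0 cl (begin
    f 0ℂ     ≈⟨ ∇^-zero (suc d) (f ∘ fromℕ) ⟨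
    ∇^ (suc d) (f ∘ fromℕ) 0  ≈⟨ hStar⇒∇^ isHStar 0 ⟩
    h* 0     ≈⟨ (O.nonNeg∧nonPos⇒≈0 (nonNegative 0 ℕ.z≤n) re-h₀≤0 , real 0 ℕ.z≤n) ⟩
    0ℂ       ∎)
    where
    open Diamond diamond
    w : ℕ → ℂ
    w i = h* i * (P (d ∸ i) x * P̄ i x)

    0<V : ∀ {i} → i ℕ.≤ d → 0ᵣ < V (d ∸ i) x i x
    0<V {i} i≤d = V-pos (d ∸ i) i (Pos-≤ (ℕ.≤⇒≤′ (ℕ.m∸n≤m d i)) p) (Pos-≤ (ℕ.≤⇒≤′ i≤d) p)

    re-w : ∀ {i} → i ℕ.≤ d → re (w i) ≈ᵣ re (h* i) *ᵣ V (d ∸ i) x i x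
    re-w {i} i≤d = F.trans (F.+-congˡ (F.-‿cong (F.*-congʳ (real i i≤d))))
      (solve 6 (λ h a b a′ b′ v → h :* (a :* a′ :+ :- (b :* :- b′)) :+ :- (con (+ 0) :* v) := h :* (a :* a′ :+ b :* b′)) F.refl
        (re (h* i)) (A (d ∸ i) x) (B (d ∸ i) x) (A i x) (B i x) (im (P (d ∸ i) x * P̄ i x)))

    sum≈0 : sum {suc d} (w ∘ toℕ) ≈ 0ℂ
    sum≈0 = J^n-cancel d (begin
      J ^ d * sum {suc d} (w ∘ toℕ)   ≈⟨ expansion-onCL d h* x ⟨
      expansion d h* (onCL x)         ≈⟨ hStar-expansion torsionFree d (newton-CL cl) (IsHStar.degree≤d isHStar) (hStar⇒∇^ isHStar) (onCL x) ⟨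
      fromℕ (d !) * f (onCL x)        ≈⟨ *-congˡ root ⟩
      fromℕ (d !) * 0ℂ                ≈⟨ zeroʳ _ ⟩
      0ℂ                              ∎)

    re-h₀≤0 : re (h* 0) ≤ 0ᵣ
    -- A positive constant coefficient makes the summand at zero strictly positive; the others are
    -- nonnegative, contradicting the zero sum.
    re-h₀≤0 0<h₀ = O.<-irrefl (F.sym (proj₁ sum≈0)) (O.pos+nonNeg
      (O.<-respʳ (F.sym (re-w ℕ.z≤n)) (F.*-pos 0<h₀ (0<V ℕ.z≤n)))
      (re-sum-nonNeg d (λ i → O.nonNeg-resp (F.sym (re-w (toℕ<n i)))
        (O.*-nonNeg (nonNegative _ (toℕ<n i)) (O.pos⇒nonNeg (0<V (toℕ<n i)))))))

theorem3p5 : {c ℓ₁ ℓ₂ ℓ₃ : Level} (R : RealField c ℓ₁ ℓ₂ ℓ₃) →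
    let open OverReals R in
    (d : ℕ) → .{{NonZero d}} →
    Σ ℝ λ α̃ →
    IsMaximum (λ β → IsRoot (p₀ d) (onCL β)) α̃ ×
    ((f : ℂ → ℂ) → IsCLPolynomial d f → Diamond d f →
    (α : ℝ) → IsRoot f (onCL α) → α ≤ α̃)
theorem3p5 R (suc d) =
  let (α̃ , A≈0 , above) = largestRoot d in
  α̃ ,
  (A≈0⇒p₀-root (suc d) A≈0 , λ β root α̃<β → Pos⇒¬p₀-root (suc d) (above α̃<β) root) ,
  λ f cl diamond α root α̃<α → Pos⇒¬root cl diamond (above α̃<α) root
  where
  open LargestRoot R
  open CriticalLine R
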